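{- Let $(X;\mathcal L_1,\dots,\mathcal L_k)$ be a multiple covering clutter with $X=[d]$ in which all lines have the same size; let $s\subseteq\mathbb{R}^d$ be the subspace in which, for each $i$, all line sums over lines of $\mathcal L_i$ are equal; $P:=[0,1]^d\cap s$; $\Gamma_{\mathcal L}$ the graph joining any two distinct collinear points; and $\mathcal H:=\{h_{jk}\cap s : jk \text{ an edge of }\Gamma_{\mathcal L},\ h_{jk}\not\supseteq s\}$ with $h_{jk}$ the hyperplane $x_j=x_k$. Assume a latin labelling exists, i.e. an integer point of $s$ whose values at any two distinct collinear points differ. Let $L_c^\circ(t)$ be the number of latin labellings $x\in\mathbb{Z}^d\cap s$ with $0<x_i<t$, and $L_c(t)$ the number of pairs consisting of an integer point $x\in s$ with $0\le x_i\le t$ and an acyclic orientation of $\Gamma_{\mathcal L}$ compatible with $x$ and realizable in $s$. Then $$L_c^\circ(t)=\sum_{u\in\mathcal L(P^\circ,\mathcal H)}\mu(\hat0,u)\,E_{(0,1)^d\cap u}(t),\qquad L_c(t)=\sum_{u\in\mathcal L(P^\circ,\mathcal H)}|\mu(\hat0,u)|\,E_{[0,1]^d\cap u}(t),$$ where $\mu$ is the Möbius function of $\mathcal L(P^\circ,\mathcal H)$.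
   Context: Covering clutter: family of nonempty subsets (lines) of $X$, none containing another, with union $X$; a multiple covering clutter is a list of such on the same $X$. An orientation is acyclic if it has no directed cycle, compatible with $x$ if $x_j\ge x_i$ for each edge oriented $i\to j$, realizable in $s$ if some $x\in s$ has $x_j>x_i$ for each edge oriented $i\to j$. $\mathcal L(P^\circ,\mathcal H):=\{P^\circ\cap\bigcap\mathcal S:\mathcal S\subseteq\mathcal H\}\setminus\{\emptyset\}$ ordered by reverse inclusion, bottom $\hat0=P^\circ$ (relative interior of $P$). $E_{Q\cap u}(t)$ is the number of integer points in $t(Q\cap\bar u)$, where $\bar u=\bigcap\mathcal S$ is the flat whose intersection with $P^\circ$ is $u$. Möbius function: $\mu(r,r)=1$, $\mu(r,s)=-\sum_{r\le w<s}\mu(r,w)$ for $r<s$.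
   Formalization: The subspace s, the polytope P with its relative interior, the elements u of the intersection poset and the points realizing an orientation are taken in ℚ^d instead of ℝ^d; the counted integer points are unaffected. -}

module Defs where

open import Data.Nat as ℕ using (ℕ; zero; suc)
open import Data.Integer as ℤ using (ℤ; +_)
open import Data.Rational as ℚ using (ℚ; 0ℚ; 1ℚ)
open import Data.Fin using (Fin; zero; suc; _<_)
open import Data.Fin.Subset using (Subset; _∈_; Nonempty; ∣_∣; _⊆_)
open import Data.Vec using (Vec; lookup)
open import Data.Bool using (Bool; true; false; if_then_else_)
open import Data.List using (List)
open import Data.List.Relation.Unary.All using (All)
open import Data.List.Relation.Unary.Unique.Propositional using (Unique)
import Data.List.Membership.Propositional as LM
open import Data.Product using (Σ; ∃; ∃-syntax; _×_; _,_)
open import Data.Sum using (_⊎_)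
open import Relation.Nullary using (¬_)
open import Relation.Binary.PropositionalEquality using (_≡_; _≢_)
open import Relation.Binary.Construct.Closure.Transitive using (TransClosure)
open import Function.Bundles using (_⇔_)

sumℚ : ∀ {n} → (Fin n → ℚ) → ℚ
sumℚ {zero}  f = 0ℚ
sumℚ {suc n} f = f zero ℚ.+ sumℚ (λ i → f (suc i))

sumℤ : ∀ {n} → (Fin n → ℤ) → ℤ
sumℤ {zero}  f = + 0
sumℤ {suc n} f = f zero ℤ.+ sumℤ (λ i → f (suc i))

-- SumOver P f z : "the sum of f j over those j : Fin n with P j equals z"
-- (a relational rendering of a sum over a possibly undecided index set)
SumOver : ∀ {n} → (Fin n → Set) → (Fin n → ℤ) → ℤ → Set
SumOver {zero}  P f z = z ≡ + 0
SumOver {suc n} P f z =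
  (P zero × SumOver (λ i → P (suc i)) (λ i → f (suc i)) (z ℤ.- f zero))
  ⊎ ((¬ P zero) × SumOver (λ i → P (suc i)) (λ i → f (suc i)) z)

CountIs : {A : Set} → (A → Set) → ℕ → Set
CountIs {A} P m =
  Σ (List A) λ xs → (Data.List.length xs ≡ m) × Unique xs × (∀ a → (a LM.∈ xs) ⇔ P a)

-- points of ℚ^d (rational stand-in for ℝ^d)
Pt : ℕ → Set
Pt d = Fin d → ℚ

ℤtoℚ : ℤ → ℚ
ℤtoℚ z = z ℚ./ 1

ptℕ : ∀ {d} → Vec ℕ d → Pt d
ptℕ x c = ℤtoℚ (+ (lookup x c))

Line : ℕ → Set
Line d = Subset d

Clutter : ℕ → Set
Clutter d = List (Line d)

IsCoveringClutter : ∀ {d} → Clutter d → Set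
IsCoveringClutter {d} C =
  All Nonempty C
  × (∀ {ℓ ℓ′} → ℓ LM.∈ C → ℓ′ LM.∈ C → ℓ ⊆ ℓ′ → ℓ ≡ ℓ′)
  × (∀ (x : Fin d) → ∃[ ℓ ] (ℓ LM.∈ C × x ∈ ℓ))

MCC : ℕ → ℕ → Set
MCC d k = Vec (Clutter d) k

IsMCC : ∀ {d k} → MCC d k → Set
IsMCC {d} {k} L = ∀ (i : Fin k) → IsCoveringClutter (lookup L i)

AllLinesSameSize : ∀ {d k} → MCC d k → Set
AllLinesSameSize {d} {k} L =
  ∃[ r ] (∀ (i : Fin k) {ℓ} → ℓ LM.∈ lookup L i → ∣ ℓ ∣ ≡ r)

Collinear : ∀ {d k} → MCC d k → Fin d → Fin d → Set
Collinear {d} {k} L a b =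
  a ≢ b × ∃[ i ] ∃[ ℓ ] (ℓ LM.∈ lookup L i × a ∈ ℓ × b ∈ ℓ)

lineSum : ∀ {d} → Pt d → Line d → ℚ
lineSum x ℓ = sumℚ (λ c → if lookup ℓ c then x c else 0ℚ)

InS : ∀ {d k} → MCC d k → Pt d → Set
InS {d} {k} L x =
  ∀ (i : Fin k) {ℓ ℓ′} → ℓ LM.∈ lookup L i → ℓ′ LM.∈ lookup L i →
  lineSum x ℓ ≡ lineSum x ℓ′

InP : ∀ {d k} → MCC d k → Pt d → Set
InP {d} L x = InS L x × (∀ c → (0ℚ ℚ.≤ x c) × (x c ℚ.≤ 1ℚ))

-- relative interior of the convex set P:
-- x ∈ P and every segment in P from a point y to x extends a bit beyond x
InPo : ∀ {d k} → MCC d k → Pt d → Set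
InPo {d} L x =
  InP L x ×
  (∀ y → InP L y → ∃[ ε ] ((0ℚ ℚ.< ε) × InP L (λ c → x c ℚ.+ ε ℚ.* (x c ℚ.- y c))))

IsLatin : ∀ {d k} → MCC d k → (Fin d → ℤ) → Set
IsLatin {d} L x =
  InS L (λ c → ℤtoℚ (x c)) × (∀ a b → Collinear L a b → x a ≢ x b)

LatinExists : ∀ {d k} → MCC d k → Set
LatinExists {d} L = ∃[ x ] IsLatin L x

Orientation : ℕ → Set
Orientation d = Vec (Vec Bool d) d

Arrow : ∀ {d} → Orientation d → Fin d → Fin d → Set
Arrow O a b = lookup (lookup O a) b ≡ true

IsOrientation : ∀ {d k} → MCC d k → Orientation d → Set
IsOrientation {d} L O =
  (∀ a b → Arrow O a b → Collinear L a b)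
  × (∀ a b → Collinear L a b → (Arrow O a b × ¬ Arrow O b a) ⊎ (Arrow O b a × ¬ Arrow O a b))

Acyclic : ∀ {d} → Orientation d → Set
Acyclic {d} O = ∀ a → ¬ TransClosure (Arrow O) a a

CompatibleWith : ∀ {d} → Orientation d → Vec ℕ d → Set
CompatibleWith {d} O x = ∀ a b → Arrow O a b → lookup x a ℕ.≤ lookup x b

RealizableIn : ∀ {d k} → MCC d k → Orientation d → Set
RealizableIn {d} L O = ∃[ y ] (InS L y × (∀ a b → Arrow O a b → y a ℚ.< y b))

LatinOpen : ∀ {d k} → MCC d k → ℕ → Vec ℕ d → Set
LatinOpen {d} L t x =
  (∀ c → (0 ℕ.< lookup x c) × (lookup x c ℕ.< t))
  × InS L (ptℕ x) × (∀ a b → Collinear L a b → lookup x a ≢ lookup x b)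

LcPair : ∀ {d k} → MCC d k → ℕ → Vec ℕ d × Orientation d → Set
LcPair {d} L t (x , O) =
  (∀ c → lookup x c ℕ.≤ t) × InS L (ptℕ x)
  × IsOrientation L O × Acyclic O × CompatibleWith O x × RealizableIn L O

-- an element of H: h_ab ∩ s for an edge ab of Γ_L (a < b) with h_ab ⊉ s
InH : ∀ {d k} → MCC d k → Fin d × Fin d → Set
InH {d} L (a , b) = (a < b) × Collinear L a b × ∃[ y ] (InS L y × y a ≢ y b)

-- the flat ⋂S (inside s) for a family S ⊆ H given by a list of edges
InFlat : ∀ {d k} → MCC d k → List (Fin d × Fin d) → Pt d → Set
InFlat {d} L S y = InS L y × All (λ { (a , b) → y a ≡ y b }) S

InU : ∀ {d k} → MCC d k → List (Fin d × Fin d) → Pt d → Set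
InU L S y = InPo L y × All (λ { (a , b) → y a ≡ y b }) S

SameSet : ∀ {d} → (Pt d → Set) → (Pt d → Set) → Set
SameSet {d} U V = ∀ y → U y ⇔ V y

SubSet : ∀ {d} → (Pt d → Set) → (Pt d → Set) → Set
SubSet {d} U V = ∀ y → U y → V y

-- reps enumerates the elements of L(P°,H) without repetition:
-- reps i is a family S_i ⊆ H with u_{S_i} ≠ ∅, every nonempty u_S equals some
-- u_{S_i}, and distinct indices give distinct sets
IsLatticeReps : ∀ {d k n} → MCC d k → Vec (List (Fin d × Fin d)) n → Set
IsLatticeReps {d} {k} {n} L reps =
  (∀ i → All (InH L) (lookup reps i) × ∃[ y ] InU L (lookup reps i) y)
  × (∀ S → All (InH L) S → ∃[ y ] InU L S y → ∃[ i ] SameSet (InU L S) (InU L (lookup reps i)))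
  × (∀ i j → SameSet (InU L (lookup reps i)) (InU L (lookup reps j)) → i ≡ j)

LatLe : ∀ {d k n} → MCC d k → Vec (List (Fin d × Fin d)) n → Fin n → Fin n → Set
LatLe L reps i j = SubSet (InU L (lookup reps j)) (InU L (lookup reps i))

IsMobiusFromBottom : ∀ {d k n} → MCC d k → Vec (List (Fin d × Fin d)) n → (Fin n → ℤ) → Set
IsMobiusFromBottom {d} {k} {n} L reps μ =
  ∀ i →
    (SameSet (InU L (lookup reps i)) (InPo L) → μ i ≡ + 1)
    × (¬ SameSet (InU L (lookup reps i)) (InPo L) →
        ∃[ z ] (SumOver (λ j → LatLe L reps j i × j ≢ i) μ z × μ i ≡ ℤ.- z))

-- integer points of t((0,1)^d ∩ ū) and of t([0,1]^d ∩ ū), ū = ⋂S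
-- (ū is a linear subspace, so t·ū = ū)
OpenPts : ∀ {d k} → MCC d k → List (Fin d × Fin d) → ℕ → Vec ℕ d → Set
OpenPts L S t x =
  (∀ c → (0 ℕ.< lookup x c) × (lookup x c ℕ.< t)) × InFlat L S (ptℕ x)

ClosedPts : ∀ {d k} → MCC d k → List (Fin d × Fin d) → ℕ → Vec ℕ d → Set
ClosedPts L S t x = (∀ c → lookup x c ℕ.≤ t) × InFlat L S (ptℕ x)

-- The constant point ½ lies on every hyperplane x_a = x_b and, since all lines have the same size, in P°;
-- hence 𝓛(P°,𝓗) is the lattice of flats of a central arrangement on s, and a latin labelling shows that
-- every edge of Γ gives an element of 𝓗.  Deletion and restriction along an ordering of the edges produce a
-- list of edge sets B (the no-broken-circuit sets), built by the rule: skip the next edge, or add it and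
-- intersect with its hyperplane; a branch dies when the next edge vanishes on the current flat.  The same
-- recursion shows
--   Σ_B (-1)^|B| [Y ⊆ ⋂B] = [Y lies on no hyperplane]   and   Σ_B [x ∈ ⋂B] = #{regions whose closure contains x}.
-- The first identity, applied to the flats Y, gives μ(0̂,u) = Σ_{⋂B = u} (-1)^|B|.  Each B is independent, so by
-- Steinitz exchange |B| depends only on ⋂B, and |μ(0̂,u)| is the number of B with ⋂B = u.  Summing both
-- identities over the integer points x gives the two formulas.
--
-- Realizability of orientations and vanishing on flats are decided classically, which is harmless because the
-- conclusions are equations between integers and therefore stable under double negation.
module Submission where

open import Defs
open import Algebra.Properties.AbelianGroup using (∙-cancelˡ)
open import Algebra.Properties.Group using (⁻¹-involutive)
open import Data.Bool using (Bool; true; false; if_then_else_; not)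
open import Data.Empty using (⊥)
open import Data.Fin as Fin using (Fin; zero; suc)
open import Data.Fin.Induction using (spo-wellFounded)
import Data.Fin.Properties as Finₚ
open import Data.Fin.Subset using () renaming (∣_∣ to size)
open import Data.Integer as ℤ using (ℤ; +_)
import Data.Integer.Properties as ℤₚ
open import Data.Integer.Tactic.RingSolver using (solve-∀)
open import Data.List using (List; []; _∷_; _++_; map; length; filter; cartesianProduct; tabulate; allFin)
open import Data.List.Membership.Propositional using (_∈_; find)
open import Data.List.Membership.Propositional.Properties using (∈-filter⁺; ∈-filter⁻; ∈-map⁺; ∈-map⁻; ∈-++⁺ˡ; ∈-++⁺ʳ; ∈-allFin; ∈-cartesianProduct⁺; ∈-cartesianProduct⁻)
open import Data.List.Membership.Propositional.Properties.WithK using (unique∧set⇒bag)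
open import Data.List.Properties using (length-map)
open import Data.List.Relation.Binary.BagAndSetEquality using (∼bag⇒↭)
open import Data.List.Relation.Binary.Permutation.Propositional.Properties using (↭-length)
open import Data.List.Relation.Unary.All as All using (All; []; _∷_)
import Data.List.Relation.Unary.All.Properties as Allₚ
open import Data.List.Relation.Unary.AllPairs using ([]; _∷_)
open import Data.List.Relation.Unary.Any as Any using (here; there)
open import Data.List.Relation.Unary.Unique.Propositional using (Unique)
import Data.List.Relation.Unary.Unique.Propositional.Properties as Uniqueₚ
open import Data.Nat as ℕ using (ℕ; zero; suc; z≤n; s≤s)
import Data.Nat.Properties as ℕₚ
open import Data.Product using (∃; Σ; _×_; _,_; proj₁; proj₂)
open import Data.Rational as ℚ using (ℚ; 0ℚ; 1ℚ; ½; NonZero; Positive; NonNegative; positive; negative; ≢-nonZero)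
import Data.Rational.Properties as ℚₚ
open import Data.Rational.Solver using (module +-*-Solver)
open import Data.Rational.Unnormalised using (mkℚᵘ; *≤*)
import Data.Rational.Unnormalised.Properties as ℚᵘₚ
open import Data.Sum as Sum using (_⊎_; inj₁; inj₂)
open import Data.Unit using (⊤; tt)
open import Data.Vec as Vec using (Vec; []; _∷_; lookup)
import Data.Vec.Properties as Vecₚ
open import Function using (_∘_; id)
open import Function.Bundles using (_⇔_; mk⇔; Equivalence)
import Induction.WellFounded as WellFounded
open import Relation.Binary.Construct.Closure.Transitive using (TransClosure; [_]; _∷_)
open import Relation.Binary.Definitions using (DecidableEquality; Tri; tri<; tri≈; tri>)
open import Relation.Binary.PropositionalEquality using (_≡_; _≢_; refl; sym; trans; cong; cong₂; subst; subst₂; isEquivalence; module ≡-Reasoning)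
open import Relation.Binary.Structures using (IsStrictPartialOrder)
open import Relation.Nullary using (¬_; Dec; yes; no; does; contradiction; ¬?; _×-dec_)
open import Relation.Nullary.Decidable using (map′; from-yes; dec-true; decidable-stable; ¬¬-excluded-middle)
open import Relation.Unary using (Decidable)

open Equivalence using (to; from)

-- Integer-valued sums over lists, indicators and counting.

module Summation where

  open import Data.Integer using (_+_; _*_; _-_)

  private variable
    A B : Set
    P Q : Set

  𝟙 : Dec P → ℤ
  𝟙 (yes _) = + 1
  𝟙 (no _)  = + 0

  𝟙-cong : P ⇔ Q → (p : Dec P) (q : Dec Q) → 𝟙 p ≡ 𝟙 q
  𝟙-cong e (yes p) (yes q) = refl
  𝟙-cong e (yes p) (no ¬q) = contradiction (to e p) ¬q
  𝟙-cong e (no ¬p) (yes q) = contradiction (from e q) ¬p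
  𝟙-cong e (no ¬p) (no ¬q) = refl

  𝟙-yes : P → (p : Dec P) → 𝟙 p ≡ + 1
  𝟙-yes p (yes _) = refl
  𝟙-yes p (no ¬p) = contradiction p ¬p

  𝟙-no : ¬ P → (p : Dec P) → 𝟙 p ≡ + 0
  𝟙-no ¬p (yes p) = contradiction p ¬p
  𝟙-no ¬p (no _)  = refl

  ∑ : List A → (A → ℤ) → ℤ
  ∑ []       f = + 0
  ∑ (x ∷ xs) f = f x + ∑ xs f

  ∑-cong-∈ : ∀ {f g : A → ℤ} xs → (∀ {x} → x ∈ xs → f x ≡ g x) → ∑ xs f ≡ ∑ xs g
  ∑-cong-∈ []       e = refl
  ∑-cong-∈ (x ∷ xs) e = cong₂ _+_ (e (here refl)) (∑-cong-∈ xs (e ∘ there))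

  ∑-cong : ∀ {f g : A → ℤ} xs → (∀ x → f x ≡ g x) → ∑ xs f ≡ ∑ xs g
  ∑-cong xs e = ∑-cong-∈ xs (λ {x} _ → e x)

  ∑-zero : (xs : List A) → ∑ xs (λ _ → + 0) ≡ + 0
  ∑-zero []       = refl
  ∑-zero (x ∷ xs) = cong (_+_ (+ 0)) (∑-zero xs)

  ∑-++ : ∀ {f : A → ℤ} xs ys → ∑ (xs ++ ys) f ≡ ∑ xs f + ∑ ys f
  ∑-++         []       ys = sym (ℤₚ.+-identityˡ _)
  ∑-++ {f = f} (x ∷ xs) ys = trans (cong (_+_ (f x)) (∑-++ xs ys)) (sym (ℤₚ.+-assoc (f x) _ _))

  ∑-map : ∀ (g : A → B) {f : B → ℤ} xs → ∑ (map g xs) f ≡ ∑ xs (f ∘ g)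
  ∑-map g         []       = refl
  ∑-map g {f = f} (x ∷ xs) = cong (_+_ (f (g x))) (∑-map g xs)

  ∑-+ : ∀ (f g : A → ℤ) xs → ∑ xs (λ x → f x + g x) ≡ ∑ xs f + ∑ xs g
  ∑-+ f g []       = refl
  ∑-+ f g (x ∷ xs) = trans (cong (_+_ (f x + g x)) (∑-+ f g xs)) (interchange (f x) (g x) _ _)
    where
    interchange : ∀ a b c e → (a + b) + (c + e) ≡ (a + c) + (b + e)
    interchange = solve-∀

  ∑-*ˡ : ∀ c (f : A → ℤ) xs → ∑ xs (λ x → c * f x) ≡ c * ∑ xs f
  ∑-*ˡ c f []       = sym (ℤₚ.*-zeroʳ c)
  ∑-*ˡ c f (x ∷ xs) = trans (cong (_+_ (c * f x)) (∑-*ˡ c f xs)) (sym (ℤₚ.*-distribˡ-+ c (f x) _))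

  ∑-*ʳ : ∀ c (f : A → ℤ) xs → ∑ xs (λ x → f x * c) ≡ ∑ xs f * c
  ∑-*ʳ c f xs = trans (∑-cong xs (λ x → ℤₚ.*-comm (f x) c)) (trans (∑-*ˡ c f xs) (ℤₚ.*-comm c _))

  ∑-swap : ∀ (f : A → B → ℤ) xs ys → ∑ xs (λ x → ∑ ys (f x)) ≡ ∑ ys (λ y → ∑ xs (λ x → f x y))
  ∑-swap f []       ys = sym (∑-zero ys)
  ∑-swap f (x ∷ xs) ys = trans (cong (_+_ (∑ ys (f x))) (∑-swap f xs ys))
                               (sym (∑-+ (f x) (λ y → ∑ xs (λ x → f x y)) ys))

  ∑-cartesianProduct : ∀ (f : A × B → ℤ) xs ys →
                       ∑ (cartesianProduct xs ys) f ≡ ∑ xs (λ x → ∑ ys (λ y → f (x , y)))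
  ∑-cartesianProduct f []       ys = refl
  ∑-cartesianProduct f (x ∷ xs) ys = trans (∑-++ (map (x ,_) ys) _)
    (cong₂ _+_ (∑-map (x ,_) ys) (∑-cartesianProduct f xs ys))

  ∑-δ : (_≟_ : DecidableEquality A) (g : A → ℤ) {xs : List A} → Unique xs →
        ∀ {k} → k ∈ xs → ∑ xs (λ x → 𝟙 (k ≟ x) * g x) ≡ g k
  ∑-δ _≟_ g {x ∷ xs} (x∉ ∷ u) (here refl) = begin
    𝟙 (x ≟ x) * g x + ∑ xs (λ y → 𝟙 (x ≟ y) * g y)
      ≡⟨ cong₂ _+_ (cong (_* g x) (𝟙-yes refl (x ≟ x)))
                   (∑-cong-∈ xs (λ {y} y∈ → cong (_* g y) (𝟙-no (All.lookup x∉ y∈) (x ≟ y)))) ⟩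
    + 1 * g x + ∑ xs (λ y → + 0 * g y)  ≡⟨ cong₂ _+_ (ℤₚ.*-identityˡ (g x)) (∑-*ˡ (+ 0) g xs) ⟩
    g x + + 0                           ≡⟨ ℤₚ.+-identityʳ (g x) ⟩
    g x                                 ∎ where open ≡-Reasoning
  ∑-δ _≟_ g {x ∷ xs} (x∉ ∷ u) {k} (there k∈) =
    trans (cong₂ _+_ (cong (_* g x) (𝟙-no (λ k≡x → All.lookup x∉ k∈ (sym k≡x)) (k ≟ x)))
                     (∑-δ _≟_ g u k∈))
          (ℤₚ.+-identityˡ (g k))

  sumℤ-∑ : ∀ {n} (f : Fin n → ℤ) → sumℤ f ≡ ∑ (allFin n) f
  sumℤ-∑ f = go id f
    where
    go : ∀ {m} {A : Set} (g : Fin m → A) (f : A → ℤ) → sumℤ (f ∘ g) ≡ ∑ (tabulate g) f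
    go {zero}  g f = refl
    go {suc m} g f = cong (_+_ (f (g zero))) (go (g ∘ suc) f)

  -- Once the index set is decided, each step of the relation can take only one branch, so the
  -- related value is forced.
  SumOver⇒sumℤ : ∀ {n} {R : Fin n → Set} (R? : Decidable R) (f : Fin n → ℤ) {z} →
                 SumOver R f z → z ≡ sumℤ (λ j → 𝟙 (R? j) * f j)
  SumOver⇒sumℤ {zero}  R? f z≡0 = z≡0
  SumOver⇒sumℤ {suc n} R? f {z} (inj₁ (r , s)) = begin
    z                                                        ≡⟨ split z (f zero) ⟩
    + 1 * f zero + (z - f zero)
      ≡⟨ cong₂ (λ a b → a * f zero + b) (sym (𝟙-yes r (R? zero))) (SumOver⇒sumℤ (R? ∘ suc) (f ∘ suc) s) ⟩
    sumℤ (λ j → 𝟙 (R? j) * f j)                              ∎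
    where
    open ≡-Reasoning
    split : ∀ z a → z ≡ + 1 * a + (z - a)
    split = solve-∀
  SumOver⇒sumℤ {suc n} R? f {z} (inj₂ (¬r , s)) = begin
    z                           ≡⟨ ℤₚ.+-identityˡ z ⟨
    + 0 * f zero + z
      ≡⟨ cong₂ (λ a b → a * f zero + b) (sym (𝟙-no ¬r (R? zero))) (SumOver⇒sumℤ (R? ∘ suc) (f ∘ suc) s) ⟩
    sumℤ (λ j → 𝟙 (R? j) * f j) ∎
    where open ≡-Reasoning

  length-filter-∑ : {R : A → Set} (R? : Decidable R) → ∀ ys → + length (filter R? ys) ≡ ∑ ys (𝟙 ∘ R?)
  length-filter-∑ R? []       = refl
  length-filter-∑ R? (y ∷ ys) with R? y
  ... | yes _ = cong (_+_ (+ 1)) (length-filter-∑ R? ys)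
  ... | no _  = trans (length-filter-∑ R? ys) (sym (ℤₚ.+-identityˡ _))

  -- Two duplicate-free lists with the same members are permutations of each other, so the given
  -- enumeration is as long as the filtered `ys`.
  CountIs⇒∑ : ∀ {S R : A → Set} {m} → CountIs S m → ∀ {ys} → Unique ys → (R? : Decidable R) →
              (∀ y → S y ⇔ (y ∈ ys × R y)) → + m ≡ ∑ ys (𝟙 ∘ R?)
  CountIs⇒∑ (xs , refl , u , ∈⇔S) {ys} v R? S⇔ = trans
    (cong +_ (↭-length (∼bag⇒↭ (unique∧set⇒bag u (Uniqueₚ.filter⁺ R? v)
      (λ {y} → mk⇔ (λ y∈ → let (y∈ys , r) = to (S⇔ y) (to (∈⇔S y) y∈) in ∈-filter⁺ R? y∈ys r)
                   (λ y∈ → from (∈⇔S y) (from (S⇔ y) (∈-filter⁻ R? y∈))))))))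
    (length-filter-∑ R? ys)

  Unique-map-∈ : (f : A → B) {xs : List A} → (∀ {x y} → x ∈ xs → y ∈ xs → f x ≡ f y → x ≡ y) →
                 Unique xs → Unique (map f xs)
  Unique-map-∈ f inj []       = []
  Unique-map-∈ f inj (x∉ ∷ u) =
    Allₚ.map⁺ (All.tabulate (λ y∈ fx≡fy → All.lookup x∉ y∈ (inj (here refl) (there y∈) fx≡fy)))
    ∷ Unique-map-∈ f (λ x∈ y∈ → inj (there x∈) (there y∈)) u

  -- Injectivity is asked on `S` alone: the map it serves, from orientations to sign vectors, is not
  -- injective on arbitrary Boolean matrices.
  CountIs-map : ∀ {S : A → Set} {T : B → Set} {m} (f : A → B) →
                (∀ {x y} → S x → S y → f x ≡ f y → x ≡ y) →
                (∀ {x} → S x → T (f x)) → (∀ {y} → T y → ∃ λ x → S x × y ≡ f x) →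
                CountIs S m → CountIs T m
  CountIs-map {T = T} f inj S⇒T T⇒S (xs , len , u , ∈⇔S) =
    map f xs , trans (length-map f xs) len ,
    Unique-map-∈ f (λ x∈ y∈ → inj (to (∈⇔S _) x∈) (to (∈⇔S _) y∈)) u ,
    λ y → mk⇔ (λ y∈ → let (x , x∈ , y≡) = ∈-map⁻ f y∈ in subst T (sym y≡) (S⇒T (to (∈⇔S x) x∈)))
              (λ Ty → let (x , Sx , y≡) = T⇒S Ty in subst (_∈ map f xs) (sym y≡) (∈-map⁺ f (from (∈⇔S x) Sx)))

open Summation

-- Order and field arithmetic of the rationals.

module RationalArithmetic where

  open import Data.Rational using (_+_; _*_; -_; _-_; 1/_; ∣_∣; _≤_; _<_)

  *-pos : ∀ {p q} → 0ℚ < p → 0ℚ < q → 0ℚ < p * q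
  *-pos {p} {q} 0<p 0<q =
    ℚₚ.positive⁻¹ (p * q) {{ℚₚ.pos*pos⇒pos p {{positive 0<p}} q {{positive 0<q}}}}

  *-nonNeg : ∀ {p q} → 0ℚ < p → 0ℚ ≤ q → 0ℚ ≤ p * q
  *-nonNeg {p} {q} 0<p 0≤q = subst (_≤ p * q) (ℚₚ.*-zeroʳ p)
    (ℚₚ.*-monoˡ-≤-nonNeg p {{ℚₚ.pos⇒nonNeg p {{positive 0<p}}}} 0≤q)

  +-pos : ∀ {p q} → 0ℚ ≤ p → 0ℚ < q → 0ℚ < p + q
  +-pos = ℚₚ.+-mono-≤-<

  neg-pos : ∀ {p} → p < 0ℚ → 0ℚ < - p
  neg-pos = ℚₚ.neg-antimono-<

  neg-neg : ∀ {p} → 0ℚ < - p → p < 0ℚ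
  neg-neg {p} 0<-p = subst (_< 0ℚ) (⁻¹-involutive ℚₚ.+-0-group p) (ℚₚ.neg-antimono-< 0<-p)

  neg-nonNeg⇒nonPos : ∀ {p} → 0ℚ ≤ - p → p ≤ 0ℚ
  neg-nonNeg⇒nonPos {p} 0≤-p = subst (_≤ 0ℚ) (⁻¹-involutive ℚₚ.+-0-group p) (ℚₚ.neg-antimono-≤ 0≤-p)

  p≤∣p∣ : ∀ p → p ≤ ∣ p ∣
  p≤∣p∣ p with ℚₚ.≤-total 0ℚ p
  ... | inj₁ 0≤p = ℚₚ.≤-reflexive (sym (ℚₚ.0≤p⇒∣p∣≡p 0≤p))
  ... | inj₂ p≤0 = ℚₚ.≤-trans p≤0 (ℚₚ.0≤∣p∣ p)

  -∣p∣≤p : ∀ p → - ∣ p ∣ ≤ p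
  -∣p∣≤p p = subst (- ∣ p ∣ ≤_) (⁻¹-involutive ℚₚ.+-0-group p)
    (ℚₚ.neg-antimono-≤ (subst (- p ≤_) (ℚₚ.∣-p∣≡∣p∣ p) (p≤∣p∣ (- p))))

  0<1+∣p∣ : ∀ p → 0ℚ < 1ℚ + ∣ p ∣
  0<1+∣p∣ p = subst (0ℚ <_) (ℚₚ.+-comm ∣ p ∣ 1ℚ) (+-pos (ℚₚ.0≤∣p∣ p) (ℚₚ.positive⁻¹ 1ℚ))

  -- Absolute value plus `p` is nonnegative. This is the factor that keeps combinations of points
  -- positive without any division.
  0<1+∣p∣+p : ∀ p → 0ℚ < (1ℚ + ∣ p ∣) + p
  0<1+∣p∣+p p = subst (0ℚ <_) eq (+-pos 0≤∣p∣+p (ℚₚ.positive⁻¹ 1ℚ))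
    where
    0≤∣p∣+p : 0ℚ ≤ ∣ p ∣ + p
    0≤∣p∣+p = subst (_≤ ∣ p ∣ + p) (ℚₚ.+-inverseʳ ∣ p ∣) (ℚₚ.+-monoʳ-≤ ∣ p ∣ (-∣p∣≤p p))
    eq : (∣ p ∣ + p) + 1ℚ ≡ (1ℚ + ∣ p ∣) + p
    eq = trans (ℚₚ.+-comm (∣ p ∣ + p) 1ℚ) (sym (ℚₚ.+-assoc 1ℚ ∣ p ∣ p))

  *-zero-cancelʳ : ∀ {p q} → p * q ≡ 0ℚ → q ≢ 0ℚ → p ≡ 0ℚ
  *-zero-cancelʳ {p} {q} pq≡0 q≢0 = begin
    p                ≡⟨ ℚₚ.*-identityʳ p ⟨
    p * 1ℚ           ≡⟨ cong (p *_) (ℚₚ.*-inverseʳ q {{nz}}) ⟨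
    p * (q * 1/q)    ≡⟨ ℚₚ.*-assoc p q 1/q ⟨
    p * q * 1/q      ≡⟨ cong (_* 1/q) pq≡0 ⟩
    0ℚ * 1/q         ≡⟨ ℚₚ.*-zeroˡ 1/q ⟩
    0ℚ               ∎
    where
    open ≡-Reasoning
    nz = ≢-nonZero q≢0
    1/q = 1/_ q {{nz}}

  signed : Bool → ℚ → ℚ
  signed true  q = q
  signed false q = - q

  signed-zero : ∀ b → signed b 0ℚ ≡ 0ℚ
  signed-zero true  = refl
  signed-zero false = refl

  signed-comb : ∀ b p x q y → signed b (p * x + q * y) ≡ p * signed b x + q * signed b y
  signed-comb true  p x q y = refl
  signed-comb false p x q y =
    solve 4 (λ p x q y → :- (p :* x :+ q :* y) := p :* (:- x) :+ q :* (:- y)) refl p x q y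
    where open +-*-Solver

  -- The fraction `ℤtoℚ z` is normalised by a gcd that does not reduce for variable `z`, so the
  -- comparison is made on the unnormalised `mkℚᵘ z 0`, whose second field is the denominator minus
  -- one.
  ℤtoℚ-mono-≤ : ∀ {z w} → z ℤ.≤ w → ℤtoℚ z ≤ ℤtoℚ w
  ℤtoℚ-mono-≤ {z} {w} z≤w = ℚₚ.toℚᵘ-cancel-≤
    (ℚᵘₚ.≤-respˡ-≃ (ℚᵘₚ.≃-sym (ℚₚ.toℚᵘ-fromℚᵘ (mkℚᵘ z 0)))
      (ℚᵘₚ.≤-respʳ-≃ (ℚᵘₚ.≃-sym (ℚₚ.toℚᵘ-fromℚᵘ (mkℚᵘ w 0)))
        (*≤* (ℤₚ.*-monoʳ-≤-nonNeg (+ 1) z≤w))))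

  ℤtoℚ-cancel-≤ : ∀ {z w} → ℤtoℚ z ≤ ℤtoℚ w → z ℤ.≤ w
  ℤtoℚ-cancel-≤ {z} {w} h with ℚᵘₚ.≤-respˡ-≃ (ℚₚ.toℚᵘ-fromℚᵘ (mkℚᵘ z 0))
    (ℚᵘₚ.≤-respʳ-≃ (ℚₚ.toℚᵘ-fromℚᵘ (mkℚᵘ w 0)) (ℚₚ.toℚᵘ-mono-≤ h))
  ... | *≤* z≤w = ℤₚ.*-cancelʳ-≤-pos z w (+ 1) z≤w

  ℤtoℚ-injective : ∀ {z w} → ℤtoℚ z ≡ ℤtoℚ w → z ≡ w
  ℤtoℚ-injective e = ℤₚ.≤-antisym (ℤtoℚ-cancel-≤ (ℚₚ.≤-reflexive e)) (ℤtoℚ-cancel-≤ (ℚₚ.≤-reflexive (sym e)))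

  p≤q⇒0≤q-p : ∀ {p q} → p ≤ q → 0ℚ ≤ q - p
  p≤q⇒0≤q-p {p} {q} h = subst (_≤ q - p) (ℚₚ.+-inverseʳ p) (ℚₚ.+-monoˡ-≤ (- p) h)

  p<q⇒0<q-p : ∀ {p q} → p < q → 0ℚ < q - p
  p<q⇒0<q-p {p} {q} h = subst (_< q - p) (ℚₚ.+-inverseʳ p) (ℚₚ.+-monoˡ-< (- p) h)

  p+[q-p]≡q : ∀ p q → p + (q - p) ≡ q
  p+[q-p]≡q = solve 2 (λ p q → p :+ (q :- p) := q) refl
    where open +-*-Solver

  -[q-p]≡p-q : ∀ p q → - (q - p) ≡ p - q
  -[q-p]≡p-q = solve 2 (λ p q → :- (q :- p) := p :- q) refl
    where open +-*-Solver

  0≤q-p⇒p≤q : ∀ {p q} → 0ℚ ≤ q - p → p ≤ q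
  0≤q-p⇒p≤q {p} {q} h = subst₂ _≤_ (ℚₚ.+-identityʳ p) (p+[q-p]≡q p q) (ℚₚ.+-monoʳ-≤ p h)

  q-p≡0⇒p≡q : ∀ {p q} → q - p ≡ 0ℚ → p ≡ q
  q-p≡0⇒p≡q {p} {q} h = trans (sym (ℚₚ.+-identityʳ p)) (trans (cong (_+_ p) (sym h)) (p+[q-p]≡q p q))

  p≡q⇒q-p≡0 : ∀ {p q} → p ≡ q → q - p ≡ 0ℚ
  p≡q⇒q-p≡0 {p} refl = ℚₚ.+-inverseʳ p

  distrib-comb : ∀ p a b q c e → (p * b + q * e) - (p * a + q * c) ≡ p * (b - a) + q * (e - c)
  distrib-comb p a b q c e = trans (interchange (p * b) (q * e) (p * a) (q * c))
                                   (sym (cong₂ _+_ (distrib p a b) (distrib q c e)))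
    where
    open +-*-Solver
    interchange : ∀ s t u v → (s + t) - (u + v) ≡ (s - u) + (t - v)
    interchange = solve 4 (λ s t u v → (s :+ t) :- (u :+ v) := (s :- u) :+ (t :- v)) refl
    distrib : ∀ p a b → p * (b - a) ≡ p * b - p * a
    distrib = solve 3 (λ p a b → p :* (b :- a) := p :* b :- p :* a) refl

  affine-injective : ∀ u {v} → 0ℚ < v → ∀ {a b} → u + v * a ≡ u + v * b → a ≡ b
  affine-injective u {v} 0<v {a} {b} h = q-p≡0⇒p≡q (*-zero-cancelʳ {b - a} {v} (begin
    (b - a) * v                ≡⟨ solve 4 (λ u v a b → (b :- a) :* v := (u :+ v :* b) :- (u :+ v :* a)) refl u v a b ⟩
    (u + v * b) - (u + v * a)  ≡⟨ p≡q⇒q-p≡0 h ⟩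
    0ℚ                         ∎) (λ v≡0 → ℚₚ.<-irrefl (sym v≡0) 0<v))
    where
    open ≡-Reasoning
    open +-*-Solver

  -- Extending the segment from `b` to `a` beyond `a` is a linear combination with one negative
  -- weight, so membership in a subspace survives it.
  extrapolate : ∀ ε a b → (1ℚ + ε) * a + (- ε) * b ≡ a + ε * (a - b)
  extrapolate = solve 3 (λ ε a b → (con 1ℚ :+ ε) :* a :+ (:- ε) :* b := a :+ ε :* (a :- b)) refl
    where open +-*-Solver

  extrapolate-mono : ∀ {ε} → 0ℚ < ε → ∀ {a a′ b b′} → a ≤ a′ → b′ ≤ b → a + ε * (a - b) ≤ a′ + ε * (a′ - b′)
  extrapolate-mono {ε} 0<ε a≤a′ b′≤b = ℚₚ.+-mono-≤ a≤a′
    (ℚₚ.*-monoˡ-≤-nonNeg ε {{ℚₚ.pos⇒nonNeg ε {{positive 0<ε}}}} (ℚₚ.+-mono-≤ a≤a′ (ℚₚ.neg-antimono-≤ b′≤b)))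

  affine-mono : ∀ u {v} → 0ℚ < v → ∀ {a b} → a ≤ b → u + v * a ≤ u + v * b
  affine-mono u {v} 0<v a≤b = ℚₚ.+-monoʳ-≤ u (ℚₚ.*-monoˡ-≤-nonNeg v {{ℚₚ.pos⇒nonNeg v {{positive 0<v}}}} a≤b)

  ¼ ¾ : ℚ
  ¼ = + 1 ℚ./ 4
  ¾ = + 3 ℚ./ 4

  0<¼ : 0ℚ < ¼
  0<¼ = ℚₚ.positive⁻¹ ¼


open RationalArithmetic

-- Sign vectors, and a pointwise inclusion-exclusion.

signs : ∀ n → List (Vec Bool n)
signs zero    = [] ∷ []
signs (suc n) = map (true ∷_) (signs n) ++ map (false ∷_) (signs n)

∈-signs : ∀ {n} (σ : Vec Bool n) → σ ∈ signs n
∈-signs []          = here refl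
∈-signs (true ∷ σ)  = ∈-++⁺ˡ (∈-map⁺ (true ∷_) (∈-signs σ))
∈-signs (false ∷ σ) = ∈-++⁺ʳ _ (∈-map⁺ (false ∷_) (∈-signs σ))

signs-unique : ∀ n → Unique (signs n)
signs-unique zero    = [] ∷ []
signs-unique (suc n) = Uniqueₚ.++⁺ (Uniqueₚ.map⁺ Vecₚ.∷-injectiveʳ (signs-unique n))
  (Uniqueₚ.map⁺ Vecₚ.∷-injectiveʳ (signs-unique n)) disjoint
  where
  disjoint : ∀ {σ} → σ ∈ map (true ∷_) (signs n) × σ ∈ map (false ∷_) (signs n) → ⊥
  disjoint (t , f) with ∈-map⁻ (true ∷_) t | ∈-map⁻ (false ∷_) f
  ... | _ , _ , refl | _ , _ , ()

∑-signs : ∀ n (f : Vec Bool (suc n) → ℤ) →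
          ∑ (signs (suc n)) f ≡ ∑ (signs n) (λ σ → f (true ∷ σ) ℤ.+ f (false ∷ σ))
∑-signs n f = trans (∑-++ (map (true ∷_) (signs n)) _)
  (trans (cong₂ ℤ._+_ (∑-map (true ∷_) (signs n)) (∑-map (false ∷_) (signs n)))
         (sym (∑-+ (f ∘ (true ∷_)) (f ∘ (false ∷_)) (signs n))))

-- Double negation commutes with finite conjunctions, so excluded middle may be assumed for all sign
-- vectors at once.
¬¬-signs : ∀ {n ℓ} {P : Vec Bool n → Set ℓ} → (∀ σ → ¬ ¬ P σ) → ¬ ¬ (∀ σ → P σ)
¬¬-signs {zero}  h k = h [] (λ p → k λ { [] → p })
¬¬-signs {suc n} h k = ¬¬-signs (h ∘ (true ∷_)) λ t → ¬¬-signs (h ∘ (false ∷_)) λ f →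
  k λ { (true ∷ σ) → t σ ; (false ∷ σ) → f σ }

-- Here `R` acts as the union and `S` as the intersection of `P` and `Q`. In the application `P` and
-- `Q` say that a region meets either side of a new hyperplane, and `S` that it meets the hyperplane
-- itself.
𝟙-inclusion-exclusion : ∀ {P Q R S : Set} → (R → P ⊎ Q) → (P → R) → (Q → R) → (P → Q → S) →
  (S → P) → (S → Q) → (p : Dec P) (q : Dec Q) (r : Dec R) (s : Dec S) →
  𝟙 p ℤ.+ 𝟙 q ≡ 𝟙 r ℤ.+ 𝟙 s
𝟙-inclusion-exclusion R⇒ P⇒R Q⇒R PQ⇒S S⇒P S⇒Q p q r s = helper p q
  where
  helper : ∀ p q → 𝟙 p ℤ.+ 𝟙 q ≡ 𝟙 r ℤ.+ 𝟙 s
  helper (yes p) (yes q) = sym (cong₂ ℤ._+_ (𝟙-yes (P⇒R p) r) (𝟙-yes (PQ⇒S p q) s))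
  helper (yes p) (no ¬q) = sym (cong₂ ℤ._+_ (𝟙-yes (P⇒R p) r) (𝟙-no (¬q ∘ S⇒Q) s))
  helper (no ¬p) (yes q) = sym (cong₂ ℤ._+_ (𝟙-yes (Q⇒R q) r) (𝟙-no (¬p ∘ S⇒P) s))
  helper (no ¬p) (no ¬q) = sym (cong₂ ℤ._+_
    (𝟙-no (λ r → Sum.[ ¬p , ¬q ] (R⇒ r)) r) (𝟙-no (¬p ∘ S⇒P) s))

sgn : ℕ → ℤ
sgn zero    = + 1
sgn (suc n) = ℤ.- sgn n

-- Cells of a central arrangement of linear forms on a subspace.

module Arrangement {Point Fn : Set} (comb : ℚ → Point → ℚ → Point → Point) (ev : Fn → Point → ℚ)
  (ev-comb : ∀ f p x q y → ev f (comb p x q y) ≡ p ℚ.* ev f x ℚ.+ q ℚ.* ev f y) where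

  open import Data.Rational using (_+_; _*_; -_; ∣_∣; _≤_; _<_; _≟_; _≤?_)

  record Subspace : Set₁ where
    field
      _∋_    : Point → Set
      closed : ∀ p q {x y} → _∋_ x → _∋_ y → _∋_ (comb p x q y)

  open Subspace

  infixl 6 _∩ker_
  _∩ker_ : Subspace → Fn → Subspace
  (V ∩ker f) ∋ y = (V ∋ y) × ev f y ≡ 0ℚ
  closed (V ∩ker f) p q {x} {y} (x∈ , fx) (y∈ , fy) = closed V p q x∈ y∈ , (begin
    ev f (comb p x q y)      ≡⟨ ev-comb f p x q y ⟩
    p * ev f x + q * ev f y  ≡⟨ cong₂ (λ a b → p * a + q * b) fx fy ⟩
    p * 0ℚ + q * 0ℚ          ≡⟨ cong₂ _+_ (ℚₚ.*-zeroʳ p) (ℚₚ.*-zeroʳ q) ⟩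
    0ℚ                       ∎)
    where open ≡-Reasoning

  -- The set `Y` is arbitrary because both flats and single points are put in its place.
  Vanishes : (Point → Set) → Fn → Set
  Vanishes Y f = ∀ y → Y y → ev f y ≡ 0ℚ

  Nonzero : Subspace → Fn → Set
  Nonzero V f = ∃ λ y → (V ∋ y) × ev f y ≢ 0ℚ

  ¬Nonzero⇒Vanishes : ∀ V f → ¬ Nonzero V f → Vanishes (V ∋_) f
  ¬Nonzero⇒Vanishes V f ¬nz y y∈ = decidable-stable (ev f y ≟ 0ℚ) (λ fy≢0 → ¬nz (y , y∈ , fy≢0))

  -- A sign vector chooses one side of each hyperplane: `Positive-on` is the open cell, and
  -- `Compatible` is given by the weak inequalities, hence is the closure of the cell when the cell
  -- is nonempty.
  Positive-on : (A : List Fn) → Vec Bool (length A) → Point → Set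
  Positive-on []      []      y = ⊤
  Positive-on (f ∷ A) (b ∷ σ) y = 0ℚ < signed b (ev f y) × Positive-on A σ y

  Compatible : (A : List Fn) → Vec Bool (length A) → Point → Set
  Compatible []      []      y = ⊤
  Compatible (f ∷ A) (b ∷ σ) y = 0ℚ ≤ signed b (ev f y) × Compatible A σ y

  compatible? : ∀ A σ y → Dec (Compatible A σ y)
  compatible? []      []      y = yes tt
  compatible? (f ∷ A) (b ∷ σ) y = (0ℚ ≤? signed b (ev f y)) ×-dec compatible? A σ y

  positive⇒compatible : ∀ A σ {y} → Positive-on A σ y → Compatible A σ y
  positive⇒compatible []      []      _       = tt
  positive⇒compatible (f ∷ A) (b ∷ σ) (h , hs) = ℚₚ.<⇒≤ h , positive⇒compatible A σ hs

  signed-ev-comb : ∀ b f p x q y →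
    signed b (ev f (comb p x q y)) ≡ p * signed b (ev f x) + q * signed b (ev f y)
  signed-ev-comb b f p x q y = trans (cong (signed b) (ev-comb f p x q y)) (signed-comb b p _ q _)

  comb-positive : ∀ A σ {p q x y} → 0ℚ < p → 0ℚ < q →
                  Compatible A σ x → Positive-on A σ y → Positive-on A σ (comb p x q y)
  comb-positive []      []      0<p 0<q _        _        = tt
  comb-positive (f ∷ A) (b ∷ σ) {p} {q} {x} {y} 0<p 0<q (c , cs) (h , hs) =
    subst (0ℚ <_) (sym (signed-ev-comb b f p x q y)) (+-pos (*-nonNeg 0<p c) (*-pos 0<q h)) ,
    comb-positive A σ 0<p 0<q cs hs

  -- With these weights f takes the value f(x) (1 + ∣f(y)∣ + f(y)), so no division is needed.
  comb-weights : ∀ b f {x} y → 0ℚ < signed b (ev f x) →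
                 0ℚ < signed b (ev f (comb (1ℚ + ∣ signed b (ev f y) ∣) x (signed b (ev f x)) y))
  comb-weights b f {x} y 0<fx = subst (0ℚ <_) (sym eq) (*-pos 0<fx (0<1+∣p∣+p fy))
    where
    fx fy : ℚ
    fx = signed b (ev f x)
    fy = signed b (ev f y)
    open +-*-Solver
    eq : signed b (ev f (comb (1ℚ + ∣ fy ∣) x fx y)) ≡ fx * ((1ℚ + ∣ fy ∣) + fy)
    eq = trans (signed-ev-comb b f (1ℚ + ∣ fy ∣) x fx y)
      (solve 3 (λ a m c → m :* a :+ a :* c := a :* (m :+ c)) refl fx (1ℚ + ∣ fy ∣) fy)

  -- A small step from a point of an open cell in any direction `v` stays in the cell. The new point
  -- is found only up to scale, and its values on all forms are recorded, since the caller needs a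
  -- form outside `A`.
  perturb : ∀ V A σ {y v} → V ∋ y → V ∋ v → Positive-on A σ y →
            ∃ λ w → (V ∋ w) × Positive-on A σ w ×
            (∃ λ p → ∃ λ q → 0ℚ < q × (∀ h → ev h w ≡ p * ev h y + q * ev h v))
  perturb V []      []      {y} {v} y∈ v∈ _        =
    comb 1ℚ y 1ℚ v , closed V 1ℚ 1ℚ y∈ v∈ , tt , 1ℚ , 1ℚ , ℚₚ.positive⁻¹ 1ℚ , λ h → ev-comb h 1ℚ y 1ℚ v
  perturb V (f ∷ A) (b ∷ σ) {y} {v} y∈ v∈ (0<fy , hs)
    with w , w∈ , ws , p , q , 0<q , w≡ ← perturb V A σ y∈ v∈ hs =
    -- The weights of `comb-weights` make `f` positive, and the forms in `A` are positive at both
    -- `y` and `w`.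
    comb m y n w , closed V m n y∈ w∈ ,
    (comb-weights b f w 0<fy ,
     comb-positive A σ (0<1+∣p∣ (signed b (ev f w))) 0<fy (positive⇒compatible A σ hs) ws) ,
    m + n * p , n * q , *-pos 0<fy 0<q , λ h → begin
      ev h (comb m y n w)                        ≡⟨ ev-comb h m y n w ⟩
      m * ev h y + n * ev h w                    ≡⟨ cong (λ a → m * ev h y + n * a) (w≡ h) ⟩
      m * ev h y + n * (p * ev h y + q * ev h v)
        ≡⟨ solve 6 (λ m n p q a c → m :* a :+ n :* (p :* a :+ q :* c) := (m :+ n :* p) :* a :+ (n :* q) :* c)
             refl m n p q (ev h y) (ev h v) ⟩
      (m + n * p) * ev h y + (n * q) * ev h v    ∎
    where
    open ≡-Reasoning
    open +-*-Solver
    m n : ℚ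
    m = 1ℚ + ∣ signed b (ev f w) ∣
    n = signed b (ev f y)

  Realizable : Subspace → (A : List Fn) → Vec Bool (length A) → Set
  Realizable V A σ = ∃ λ y → (V ∋ y) × Positive-on A σ y

  module _ {V : Subspace} {f : Fn} {A : List Fn} {σ : Vec Bool (length A)} where

    realizable-tail : ∀ {b} → Realizable V (f ∷ A) (b ∷ σ) → Realizable V A σ
    realizable-tail (y , y∈ , _ , h) = y , y∈ , h

    -- Moving a point of the cell far enough toward `x` gives `f` its sign at `x`, while the other
    -- signs hold because `x` is in the closed cell.
    realizable-toward : ∀ {b x} → V ∋ x → Compatible A σ x → 0ℚ < signed b (ev f x) →
                        Realizable V A σ → Realizable V (f ∷ A) (b ∷ σ)
    realizable-toward {b} {x} x∈ c 0<fx (y , y∈ , h) =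
      comb m x n y , closed V m n x∈ y∈ , comb-weights b f y 0<fx ,
      comb-positive A σ (0<1+∣p∣ (signed b (ev f y))) 0<fx c h
      where
      m n : ℚ
      m = 1ℚ + ∣ signed b (ev f y) ∣
      n = signed b (ev f x)

    -- The segment between points on opposite sides crosses the hyperplane; cross-weighting with the
    -- two values of `f` makes them cancel.
    realizable-cut : Realizable V (f ∷ A) (true ∷ σ) → Realizable V (f ∷ A) (false ∷ σ) →
                     Realizable (V ∩ker f) A σ
    realizable-cut (y , y∈ , 0<fy , hy) (z , z∈ , 0<-fz , hz) =
      comb m y n z , (closed V m n y∈ z∈ ,
        trans (ev-comb f m y n z) (solve 2 (λ a c → (:- c) :* a :+ a :* c := con 0ℚ) refl (ev f y) (ev f z))) ,
      comb-positive A σ 0<-fz 0<fy (positive⇒compatible A σ hy) hz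
      where
      open +-*-Solver
      m n : ℚ
      m = - ev f z
      n = ev f y

    -- A cell point on the hyperplane can be pushed off to either side, along a direction on which
    -- `f` is nonzero.
    realizable-uncut : ∀ b → Nonzero V f → Realizable (V ∩ker f) A σ → Realizable V (f ∷ A) (b ∷ σ)
    realizable-uncut b (v , v∈ , fv≢0) (y , (y∈ , fy≡0) , h)
      -- Scaling the direction `v` by its own signed value makes the signed value of `f` a positive
      -- multiple of a square. The second summand, with weight zero, only fills the two-term
      -- combination.
      with w , w∈ , ws , p , q , 0<q , w≡ ← perturb V A σ y∈ (closed V (signed b (ev f v)) 0ℚ v∈ v∈) h =
      w , w∈ , subst (0ℚ <_) (sym (eq p q w (w≡ f))) (*-pos 0<q (square-pos fv≢0)) , ws
      where
      open ≡-Reasoning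
      c : ℚ
      c = signed b (ev f v)
      square-pos : ∀ {a} → a ≢ 0ℚ → 0ℚ < a * a
      square-pos {a} a≢0 with ℚₚ.<-cmp a 0ℚ
      ... | tri< a<0 _ _ = ℚₚ.positive⁻¹ (a * a) {{ℚₚ.neg*neg⇒pos a {{negative a<0}} a {{negative a<0}}}}
      ... | tri≈ _ a≡0 _ = contradiction a≡0 a≢0
      ... | tri> _ _ 0<a = *-pos 0<a 0<a
      signed-square : ∀ b a q → signed b (q * (signed b a * a)) ≡ q * (a * a)
      signed-square true  a q = refl
      signed-square false a q = let open +-*-Solver in
        solve 2 (λ a q → :- (q :* ((:- a) :* a)) := q :* (a :* a)) refl a q
      eq : ∀ p q w → ev f w ≡ p * ev f y + q * ev f (comb c v 0ℚ v) →
           signed b (ev f w) ≡ q * (ev f v * ev f v)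
      eq p q w w≡ = trans (cong (signed b) (begin
        ev f w                                              ≡⟨ w≡ ⟩
        p * ev f y + q * ev f (comb c v 0ℚ v)               ≡⟨ cong₂ (λ a e → p * a + q * e) fy≡0 (ev-comb f c v 0ℚ v) ⟩
        p * 0ℚ + q * (c * ev f v + 0ℚ * ev f v)
          ≡⟨ (let open +-*-Solver in solve 4 (λ p q c a → p :* con 0ℚ :+ q :* (c :* a :+ con 0ℚ :* a) := q :* (c :* a)) refl p q c (ev f v)) ⟩
        q * (c * ev f v) ∎)) (signed-square b (ev f v) q)

    realizable-split : Nonzero V f → Realizable V A σ →
                       Realizable V (f ∷ A) (true ∷ σ) ⊎ Realizable V (f ∷ A) (false ∷ σ)
    realizable-split nz (y , y∈ , h) with ℚₚ.<-cmp 0ℚ (ev f y)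
    ... | tri< 0<fy _ _ = inj₁ (y , y∈ , 0<fy , h)
    ... | tri≈ _ 0≡fy _ = inj₁ (realizable-uncut true nz (y , (y∈ , sym 0≡fy) , h))
    ... | tri> _ _ fy<0 = inj₂ (y , y∈ , neg-pos fy<0 , h)

  -- The deletion-restriction tree and its two counting identities.

  data Decided : Subspace → List Fn → Set₁ where
    leaf : ∀ {V} → (∀ σ → Dec (Realizable V [] σ)) → Decided V []
    node : ∀ {V f A} → Dec (Nonzero V f) → (∀ σ → Dec (Realizable V (f ∷ A) σ)) →
           Decided V A → Decided (V ∩ker f) A → Decided V (f ∷ A)

  -- Only finitely many instances of excluded middle occur along the tree. Storing their outcomes in
  -- it lets all later sums run by recursion, the first subtree deleting `f` and the second
  -- restricting to its kernel.
  ¬¬-decided : ∀ V A → ¬ ¬ Decided V A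
  ¬¬-decided V []      k = ¬¬-signs (λ _ → ¬¬-excluded-middle) λ r → k (leaf r)
  ¬¬-decided V (f ∷ A) k = ¬¬-excluded-middle λ nz → ¬¬-signs (λ _ → ¬¬-excluded-middle) λ r →
    ¬¬-decided V A λ T → ¬¬-decided (V ∩ker f) A λ T′ → k (node nz r T T′)

  realizable? : ∀ {V A} → Decided V A → ∀ σ → Dec (Realizable V A σ)
  realizable? (leaf r)       = r
  realizable? (node _ r _ _) = r

  -- If `f` vanishes on `V`, no point of `V` lies off the arrangement and no cell is realizable; the
  -- empty list matches both facts.
  nbc : ∀ {V A} → Decided V A → List (List Fn)
  nbc (leaf _)                         = [] ∷ []
  nbc (node (no _) _ _ _)              = []
  nbc (node {f = f} (yes _) _ T T′)    = nbc T ++ map (f ∷_) (nbc T′)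

  Region : Subspace → (A : List Fn) → Point → Vec Bool (length A) → Set
  Region V A x σ = Realizable V A σ × Compatible A σ x

  region? : ∀ {V A} → Decided V A → ∀ x σ → Dec (Region V A x σ)
  region? {A = A} T x σ = realizable? T σ ×-dec compatible? A σ x

  ker : List Fn → Point → Set
  ker B y = All (λ f → ev f y ≡ 0ℚ) B

  zeros? : ∀ x B → Dec (ker B x)
  zeros? x B = All.all? (λ f → ev f x ≟ 0ℚ) B

  ∑-nbc-node : ∀ {V f A} nz (r : ∀ σ → Dec (Realizable V (f ∷ A) σ)) (T : Decided V A) T′ (g : List Fn → ℤ) →
               ∑ (nbc (node (yes nz) r T T′)) g ≡ ∑ (nbc T) g ℤ.+ ∑ (nbc T′) (g ∘ (f ∷_))
  ∑-nbc-node {f = f} nz r T T′ g = trans (∑-++ (nbc T) _) (cong (ℤ._+_ (∑ (nbc T) g)) (∑-map (f ∷_) (nbc T′)))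

  -- Induction on the tree. If `f` is nonzero at `x`, the regions touching `x` are those of the
  -- deletion, each on the side of `x`, and no set containing `f` counts. If `f` is zero at `x`, a
  -- region of the deletion counts once more exactly when the hyperplane cuts it.
  ∑-regions : ∀ {V A} (T : Decided V A) {x} → V ∋ x →
              ∑ (signs (length A)) (𝟙 ∘ region? T x) ≡ ∑ (nbc T) (𝟙 ∘ zeros? x)
  ∑-regions {V} (leaf r) {x} x∈ =
    cong (ℤ._+ + 0) (𝟙-yes ((x , x∈ , tt) , tt) (region? {V} (leaf r) x []))
  ∑-regions {V} {f ∷ A} (node (no ¬nz) r T T′) {x} x∈ = trans
    (∑-cong (signs (suc (length A))) (λ σ → 𝟙-no (λ { (h , _) → none σ h }) (region? (node (no ¬nz) r T T′) x σ)))
    (∑-zero (signs (suc (length A))))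
    where
    none : ∀ σ → ¬ Realizable V (f ∷ A) σ
    none (b ∷ σ) (y , y∈ , 0<fy , _) = ℚₚ.<-irrefl refl
      (subst (0ℚ <_) (trans (cong (signed b) (¬Nonzero⇒Vanishes V f ¬nz y y∈)) (signed-zero b)) 0<fy)
  ∑-regions {V} {f ∷ A} (node (yes nz) r T T′) {x} x∈ = begin
    ∑ (signs (suc (length A))) (𝟙 ∘ D)
      ≡⟨ ∑-signs (length A) (𝟙 ∘ D) ⟩
    ∑ (signs (length A)) (λ σ → 𝟙 (D (true ∷ σ)) ℤ.+ 𝟙 (D (false ∷ σ)))
      ≡⟨ step (ℚₚ.<-cmp 0ℚ (ev f x)) ⟩
    ∑ (nbc T) (𝟙 ∘ zeros? x) ℤ.+ ∑ (nbc T′) (λ B → 𝟙 (zeros? x (f ∷ B)))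
      ≡⟨ ∑-nbc-node nz r T T′ (𝟙 ∘ zeros? x) ⟨
    ∑ (nbc (node (yes nz) r T T′)) (𝟙 ∘ zeros? x) ∎
    where
    open ≡-Reasoning
    D = region? (node (yes nz) r T T′) x
    no-zeros : ev f x ≢ 0ℚ → ∑ (nbc T′) (λ B → 𝟙 (zeros? x (f ∷ B))) ≡ + 0
    no-zeros fx≢0 = trans (∑-cong (nbc T′) (λ B → 𝟙-no (λ { (fx≡0 ∷ _) → fx≢0 fx≡0 }) (zeros? x (f ∷ B))))
                          (∑-zero (nbc T′))
    off : ev f x ≢ 0ℚ →
      (∀ σ → 𝟙 (D (true ∷ σ)) ℤ.+ 𝟙 (D (false ∷ σ)) ≡ 𝟙 (region? T x σ)) →
      ∑ (signs (length A)) (λ σ → 𝟙 (D (true ∷ σ)) ℤ.+ 𝟙 (D (false ∷ σ)))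
      ≡ ∑ (nbc T) (𝟙 ∘ zeros? x) ℤ.+ ∑ (nbc T′) (λ B → 𝟙 (zeros? x (f ∷ B)))
    off fx≢0 h = begin
      ∑ (signs (length A)) (λ σ → 𝟙 (D (true ∷ σ)) ℤ.+ 𝟙 (D (false ∷ σ)))  ≡⟨ ∑-cong (signs (length A)) h ⟩
      ∑ (signs (length A)) (𝟙 ∘ region? T x)                                ≡⟨ ∑-regions T x∈ ⟩
      ∑ (nbc T) (𝟙 ∘ zeros? x)                                              ≡⟨ ℤₚ.+-identityʳ _ ⟨
      ∑ (nbc T) (𝟙 ∘ zeros? x) ℤ.+ + 0
        ≡⟨ cong (ℤ._+_ (∑ (nbc T) (𝟙 ∘ zeros? x))) (no-zeros fx≢0) ⟨
      ∑ (nbc T) (𝟙 ∘ zeros? x) ℤ.+ ∑ (nbc T′) (λ B → 𝟙 (zeros? x (f ∷ B)))  ∎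
    side : ∀ b σ → 0ℚ < signed b (ev f x) → Region V (f ∷ A) x (b ∷ σ) ⇔ Region V A x σ
    side b σ 0<fx = mk⇔ (λ { (h , _ , c) → realizable-tail {V} {f} {A} {b = b} h , c })
      (λ { (h , c) → realizable-toward {V} {f} {A} {b = b} x∈ c 0<fx h , ℚₚ.<⇒≤ 0<fx , c })
    step : Tri (0ℚ < ev f x) (0ℚ ≡ ev f x) (ev f x < 0ℚ) →
      ∑ (signs (length A)) (λ σ → 𝟙 (D (true ∷ σ)) ℤ.+ 𝟙 (D (false ∷ σ)))
      ≡ ∑ (nbc T) (𝟙 ∘ zeros? x) ℤ.+ ∑ (nbc T′) (λ B → 𝟙 (zeros? x (f ∷ B)))
    step (tri< 0<fx fx≢0 _) = off (fx≢0 ∘ sym) λ σ → trans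
      (cong₂ ℤ._+_ (𝟙-cong (side true σ 0<fx) (D (true ∷ σ)) (region? T x σ))
                   (𝟙-no (λ { (_ , 0≤-fx , _) → ℚₚ.<-irrefl refl (ℚₚ.<-≤-trans 0<fx (neg-nonNeg⇒nonPos 0≤-fx)) }) (D (false ∷ σ))))
      (ℤₚ.+-identityʳ _)
    step (tri> _ fx≢0 fx<0) = off (fx≢0 ∘ sym) λ σ → trans
      (cong₂ ℤ._+_ (𝟙-no (λ { (_ , 0≤fx , _) → ℚₚ.<-irrefl refl (ℚₚ.<-≤-trans fx<0 0≤fx) }) (D (true ∷ σ)))
                   (𝟙-cong (side false σ (neg-pos fx<0)) (D (false ∷ σ)) (region? T x σ)))
      (ℤₚ.+-identityˡ _)
    step (tri≈ _ 0≡fx _) = begin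
      ∑ (signs (length A)) (λ σ → 𝟙 (D (true ∷ σ)) ℤ.+ 𝟙 (D (false ∷ σ)))
        -- Every region of the deletion meets at least one side of the hyperplane, and it meets both
        -- exactly when it is a region of the restriction.
        ≡⟨ ∑-cong (signs (length A)) (λ σ → 𝟙-inclusion-exclusion
             (λ { (h , c) → Sum.map (λ h → h , 0≤ true , c) (λ h → h , 0≤ false , c)
                              (realizable-split {V} {f} {A} nz h) })
             (λ { (h , _ , c) → realizable-tail {V} {f} {A} {b = true} h , c })
             (λ { (h , _ , c) → realizable-tail {V} {f} {A} {b = false} h , c })
             (λ { (h , _ , c) (h′ , _) → realizable-cut {V} {f} {A} h h′ , c })
             (λ { (h , c) → realizable-uncut {V} {f} {A} true nz h , 0≤ true , c })
             (λ { (h , c) → realizable-uncut {V} {f} {A} false nz h , 0≤ false , c })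
             (D (true ∷ σ)) (D (false ∷ σ)) (region? T x σ) (region? T′ x σ)) ⟩
      ∑ (signs (length A)) (λ σ → 𝟙 (region? T x σ) ℤ.+ 𝟙 (region? T′ x σ))
        ≡⟨ ∑-+ (𝟙 ∘ region? T x) (𝟙 ∘ region? T′ x) (signs (length A)) ⟩
      ∑ (signs (length A)) (𝟙 ∘ region? T x) ℤ.+ ∑ (signs (length A)) (𝟙 ∘ region? T′ x)
        ≡⟨ cong₂ ℤ._+_ (∑-regions T x∈) (∑-regions T′ (x∈ , sym 0≡fx)) ⟩
      ∑ (nbc T) (𝟙 ∘ zeros? x) ℤ.+ ∑ (nbc T′) (𝟙 ∘ zeros? x)
        ≡⟨ cong (ℤ._+_ (∑ (nbc T) (𝟙 ∘ zeros? x))) (∑-cong (nbc T′)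
             (λ B → 𝟙-cong (mk⇔ (sym 0≡fx ∷_) All.tail) (zeros? x B) (zeros? x (f ∷ B)))) ⟩
      ∑ (nbc T) (𝟙 ∘ zeros? x) ℤ.+ ∑ (nbc T′) (λ B → 𝟙 (zeros? x (f ∷ B))) ∎
      where
      0≤ : ∀ b → 0ℚ ≤ signed b (ev f x)
      0≤ b = ℚₚ.≤-reflexive (sym (trans (cong (signed b) (sym 0≡fx)) (signed-zero b)))

  -- If `f` vanishes on `Y`, deletion and restriction contribute opposite amounts; if not, the sets
  -- containing `f` contribute nothing and `f` may be dropped from the condition.
  ∑-nbc-sgn : ∀ {V A} (T : Decided V A) {Y} → (∀ {y} → Y y → V ∋ y) → (Z? : ∀ f → Dec (Vanishes Y f)) →
              ∑ (nbc T) (λ B → sgn (length B) ℤ.* 𝟙 (All.all? Z? B)) ≡ 𝟙 (All.all? (¬? ∘ Z?) A)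
  ∑-nbc-sgn (leaf _) Y⊆V Z? = refl
  ∑-nbc-sgn {V} {f ∷ A} (node (no ¬nz) r T T′) Y⊆V Z? = sym (𝟙-no
    (λ { (h ∷ _) → h (λ y y∈ → ¬Nonzero⇒Vanishes V f ¬nz y (Y⊆V y∈)) }) (All.all? (¬? ∘ Z?) (f ∷ A)))
  ∑-nbc-sgn {V} {f ∷ A} (node (yes nz) r T T′) {Y} Y⊆V Z? = trans (∑-nbc-node nz r T T′ g) (step (Z? f))
    where
    open ≡-Reasoning
    g : List Fn → ℤ
    g B = sgn (length B) ℤ.* 𝟙 (All.all? Z? B)
    step : Dec (Vanishes Y f) → ∑ (nbc T) g ℤ.+ ∑ (nbc T′) (g ∘ (f ∷_)) ≡ 𝟙 (All.all? (¬? ∘ Z?) (f ∷ A))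
    step (yes z) = begin
      ∑ (nbc T) g ℤ.+ ∑ (nbc T′) (g ∘ (f ∷_))
        ≡⟨ cong (ℤ._+_ (∑ (nbc T) g)) (∑-cong (nbc T′) (λ B → trans
             (cong (ℤ._*_ (ℤ.- sgn (length B))) (𝟙-cong (mk⇔ All.tail (z ∷_)) (All.all? Z? (f ∷ B)) (All.all? Z? B)))
             (flip (sgn (length B)) (𝟙 (All.all? Z? B))))) ⟩
      ∑ (nbc T) g ℤ.+ ∑ (nbc T′) (λ B → ℤ.- (+ 1) ℤ.* g B)
        ≡⟨ cong (ℤ._+_ (∑ (nbc T) g)) (∑-*ˡ (ℤ.- (+ 1)) g (nbc T′)) ⟩
      ∑ (nbc T) g ℤ.+ ℤ.- (+ 1) ℤ.* ∑ (nbc T′) g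
        -- As `f` vanishes on `Y`, the set `Y` lies in the restricted subspace too, so both sums
        -- equal the same indicator `I`.
        ≡⟨ cong₂ (λ a b → a ℤ.+ ℤ.- (+ 1) ℤ.* b) (∑-nbc-sgn T Y⊆V Z?)
                 (∑-nbc-sgn T′ (λ y∈ → Y⊆V y∈ , z _ y∈) Z?) ⟩
      I ℤ.+ ℤ.- (+ 1) ℤ.* I  ≡⟨ cancel I ⟩
      + 0                    ≡⟨ 𝟙-no (λ { (¬z ∷ _) → ¬z z }) (All.all? (¬? ∘ Z?) (f ∷ A)) ⟨
      𝟙 (All.all? (¬? ∘ Z?) (f ∷ A)) ∎
      where
      I = 𝟙 (All.all? (¬? ∘ Z?) A)
      flip : ∀ a b → (ℤ.- a) ℤ.* b ≡ ℤ.- (+ 1) ℤ.* (a ℤ.* b)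
      flip = solve-∀
      cancel : ∀ a → a ℤ.+ ℤ.- (+ 1) ℤ.* a ≡ + 0
      cancel = solve-∀
    step (no ¬z) = begin
      ∑ (nbc T) g ℤ.+ ∑ (nbc T′) (g ∘ (f ∷_))
        ≡⟨ cong (ℤ._+_ (∑ (nbc T) g)) (∑-cong (nbc T′) (λ B →
             trans (cong (ℤ._*_ (ℤ.- sgn (length B))) (𝟙-no (λ { (z ∷ _) → ¬z z }) (All.all? Z? (f ∷ B))))
                   (ℤₚ.*-zeroʳ (ℤ.- sgn (length B))))) ⟩
      ∑ (nbc T) g ℤ.+ ∑ (nbc T′) (λ _ → + 0)  ≡⟨ cong (ℤ._+_ (∑ (nbc T) g)) (∑-zero (nbc T′)) ⟩
      ∑ (nbc T) g ℤ.+ + 0                     ≡⟨ ℤₚ.+-identityʳ _ ⟩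
      ∑ (nbc T) g                             ≡⟨ ∑-nbc-sgn T Y⊆V Z? ⟩
      𝟙 (All.all? (¬? ∘ Z?) A)
        ≡⟨ 𝟙-cong (mk⇔ (¬z ∷_) All.tail) (All.all? (¬? ∘ Z?) A) (All.all? (¬? ∘ Z?) (f ∷ A)) ⟩
      𝟙 (All.all? (¬? ∘ Z?) (f ∷ A))          ∎

  -- Linear independence and Steinitz exchange.

  Flag : Subspace → List Fn → Set
  Flag V []      = ⊤
  Flag V (f ∷ B) = Nonzero V f × Flag (V ∩ker f) B

  -- A `Flag` expresses linear independence on `V` in triangular form. The recursion adds a form
  -- only together with a witness that it is nonzero on the current flat.
  nbc-flags : ∀ {V A} (T : Decided V A) → All (Flag V) (nbc T)
  nbc-flags (leaf _)               = tt ∷ []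
  nbc-flags (node (no _) _ _ _)    = []
  nbc-flags (node (yes nz) _ T T′) =
    Allₚ.++⁺ (nbc-flags T) (Allₚ.map⁺ (All.map (nz ,_) (nbc-flags T′)))

  _⊑_ : Subspace → Subspace → Set
  V ⊑ W = ∀ {y} → V ∋ y → W ∋ y

  Flag-mono : ∀ {V W} B → V ⊑ W → Flag V B → Flag W B
  Flag-mono []      V⊑W _                   = tt
  Flag-mono (f ∷ B) V⊑W ((y , y∈ , fy≢0) , F) =
    (y , V⊑W y∈ , fy≢0) , Flag-mono B (λ { (y∈ , fy) → V⊑W y∈ , fy }) F

  -- The combination f(w) x − f(x) w lies in the kernel of f.
  hyperplane-maximal : ∀ V f g → Nonzero V g → Vanishes ((V ∩ker f) ∋_) g → Vanishes ((V ∩ker g) ∋_) f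
  hyperplane-maximal V f g (w , w∈ , gw≢0) van x (x∈ , gx≡0) =
    ℚₚ.neg-injective (*-zero-cancelʳ (begin
      - ev f x * ev g w                     ≡⟨ solve 3 (λ p q a → q :* a := p :* con 0ℚ :+ q :* a) refl (ev f w) (- ev f x) (ev g w) ⟩
      ev f w * 0ℚ + - ev f x * ev g w       ≡⟨ cong (λ a → ev f w * a + - ev f x * ev g w) gx≡0 ⟨
      ev f w * ev g x + - ev f x * ev g w   ≡⟨ ev-comb g (ev f w) x (- ev f x) w ⟨
      ev g z                                ≡⟨ van z (closed V (ev f w) (- ev f x) x∈ w∈ , fz≡0) ⟩
      0ℚ                                    ∎) gw≢0)
    where
    open ≡-Reasoning
    open +-*-Solver
    z = comb (ev f w) x (- ev f x) w
    fz≡0 : ev f z ≡ 0ℚ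
    fz≡0 = trans (ev-comb f (ev f w) x (- ev f x) w)
      (solve 2 (λ a c → a :* c :+ (:- c) :* a := con 0ℚ) refl (ev f w) (ev f x))

  -- Passing to the kernel of `f` costs a flag at most one form: the first `g` that dies there. At
  -- that point `f` and `g` cut out the same hyperplane, so the rest of the flag survives. Finding
  -- this `g` is a classical choice.
  flag-∩ker : ∀ V f B → Flag V B →
    ¬ ¬ (∃ λ C → Flag (V ∩ker f) C × length B ℕ.≤ suc (length C) × (∀ {y} → ker B y → ker C y))
  flag-∩ker V f []      _        k = k ([] , tt , z≤n , id)
  flag-∩ker V f (g ∷ B) (nz , F) k = ¬¬-excluded-middle λ
    { (yes nz′) → flag-∩ker (V ∩ker g) f B F λ { (C , F′ , len , sub) →
        k (g ∷ C , (nz′ , Flag-mono C (λ { ((y∈ , gy) , fy) → (y∈ , fy) , gy }) F′) , s≤s len ,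
           λ { (p ∷ ps) → p ∷ sub ps }) }
    ; (no ¬nz′) →
        let van = hyperplane-maximal V f g nz (¬Nonzero⇒Vanishes (V ∩ker f) g ¬nz′) in
        k (B , Flag-mono B (λ { {y} (y∈ , gy) → y∈ , van y (y∈ , gy) }) F , ℕₚ.≤-refl , All.tail) }

  -- Restrict to the kernels of the forms in `C` one after the other. Each restriction shortens the
  -- flag by at most one, and once `C` is exhausted no form of the flag can remain nonzero.
  steinitz : ∀ V B C → Flag V B → (∀ {y} → V ∋ y → ker C y → ker B y) → length B ℕ.≤ length C
  steinitz V []      C       _                   h = z≤n
  steinitz V (g ∷ B) []      ((y , y∈ , gy≢0) , _) h = contradiction (All.head (h y∈ [])) gy≢0
  -- Comparison of natural numbers is decidable, so the double negation of the exchange step can be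
  -- removed.
  steinitz V B@(_ ∷ _) (f ∷ C) F                   h = decidable-stable (length B ℕ.≤? suc (length C))
    λ k → flag-∩ker V f B F λ { (B′ , F′ , len , sub) →
      k (ℕₚ.≤-trans len (s≤s (steinitz (V ∩ker f) B′ C F′ (λ { (y∈ , fy) c → sub (h y∈ (fy ∷ c)) })))) }

  flags-same-length : ∀ V B C → Flag V B → Flag V C → (∀ {y} → V ∋ y → ker B y ⇔ ker C y) →
                      length B ≡ length C
  flags-same-length V B C F G e = ℕₚ.≤-antisym (steinitz V B C F (λ y∈ → from (e y∈)))
                                               (steinitz V C B G (λ y∈ → to (e y∈)))

-- Linear combinations, line sums and rescaling of rational points.

module Points where

  open import Data.Rational using (_+_; _*_; -_; 1/_; ∣_∣; _≤_; _<_; _≤?_)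

  comb : ∀ {d} → ℚ → Pt d → ℚ → Pt d → Pt d
  comb p x q y c = p * x c + q * y c

  sumℚ-cong : ∀ {n} {f g : Fin n → ℚ} → (∀ i → f i ≡ g i) → sumℚ f ≡ sumℚ g
  sumℚ-cong {zero}  e = refl
  sumℚ-cong {suc n} e = cong₂ _+_ (e zero) (sumℚ-cong (e ∘ suc))

  sumℚ-comb : ∀ {n} p (f : Fin n → ℚ) q g → sumℚ (comb p f q g) ≡ p * sumℚ f + q * sumℚ g
  sumℚ-comb {zero}  p f q g = sym (cong₂ _+_ (ℚₚ.*-zeroʳ p) (ℚₚ.*-zeroʳ q))
  sumℚ-comb {suc n} p f q g = trans (cong (_+_ (comb p f q g zero)) (sumℚ-comb p (f ∘ suc) q (g ∘ suc)))
    (solve 6 (λ p q a b s t → (p :* a :+ q :* b) :+ (p :* s :+ q :* t) := p :* (a :+ s) :+ q :* (b :+ t))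
      refl p q (f zero) (g zero) (sumℚ (f ∘ suc)) (sumℚ (g ∘ suc)))
    where open +-*-Solver

  sumℚ-nonNeg : ∀ {n} {f : Fin n → ℚ} → (∀ i → 0ℚ ≤ f i) → 0ℚ ≤ sumℚ f
  sumℚ-nonNeg {zero}  h = ℚₚ.≤-refl
  sumℚ-nonNeg {suc n} h = ℚₚ.+-mono-≤ (h zero) (sumℚ-nonNeg (h ∘ suc))

  term≤sumℚ : ∀ {n} {f : Fin n → ℚ} → (∀ i → 0ℚ ≤ f i) → ∀ i → f i ≤ sumℚ f
  term≤sumℚ {suc n} {f} h zero    = subst (_≤ sumℚ f) (ℚₚ.+-identityʳ _) (ℚₚ.+-monoʳ-≤ (f zero) (sumℚ-nonNeg (h ∘ suc)))
  term≤sumℚ {suc n} {f} h (suc i) = subst (_≤ sumℚ f) (ℚₚ.+-identityˡ _) (ℚₚ.+-mono-≤ (h zero) (term≤sumℚ (h ∘ suc) i))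

  lineSum-cong : ∀ {d} {x y : Pt d} → (∀ c → x c ≡ y c) → ∀ ℓ → lineSum x ℓ ≡ lineSum y ℓ
  lineSum-cong e ℓ = sumℚ-cong (λ c → cong (λ a → if lookup ℓ c then a else 0ℚ) (e c))

  lineSum-comb : ∀ {d} p (x : Pt d) q y ℓ → lineSum (comb p x q y) ℓ ≡ p * lineSum x ℓ + q * lineSum y ℓ
  lineSum-comb {d} p x q y ℓ = trans (sumℚ-cong (λ c → on-line (lookup ℓ c) c)) (sumℚ-comb {d} p _ q _)
    where
    on-line : ∀ b c → (if b then comb p x q y c else 0ℚ) ≡
                      p * (if b then x c else 0ℚ) + q * (if b then y c else 0ℚ)
    on-line true  c = refl
    on-line false c = sym (cong₂ _+_ (ℚₚ.*-zeroʳ p) (ℚₚ.*-zeroʳ q))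

  lineSum-const : ∀ {d} p (ℓ ℓ′ : Line d) → size ℓ ≡ size ℓ′ → lineSum (λ _ → p) ℓ ≡ lineSum (λ _ → p) ℓ′
  lineSum-const p ℓ ℓ′ e = trans (multiple ℓ) (trans (cong times e) (sym (multiple ℓ′)))
    where
    times : ℕ → ℚ
    times zero    = 0ℚ
    times (suc m) = p + times m
    multiple : ∀ {m} (ℓ : Line m) → lineSum (λ _ → p) ℓ ≡ times (size ℓ)
    multiple []          = refl
    multiple (true ∷ ℓ)  = cong (_+_ p) (multiple ℓ)
    multiple (false ∷ ℓ) = trans (ℚₚ.+-identityˡ _) (multiple ℓ)

  -- The scale is the inverse of one plus the sum of all absolute values, a bound on every
  -- coordinate that is invertible even for the zero point.
  bounded-multiple : ∀ {n} (y : Fin n → ℚ) → ∃ λ e → 0ℚ < e × (∀ c → - 1ℚ ≤ e * y c) × (∀ c → e * y c ≤ 1ℚ)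
  bounded-multiple y = e , ℚₚ.positive⁻¹ e , lo , hi
    where
    s M e : ℚ
    s = sumℚ (λ c → ∣ y c ∣)
    M = 1ℚ + s
    0<M : 0ℚ < M
    0<M = subst (0ℚ <_) (ℚₚ.+-comm s 1ℚ) (+-pos (sumℚ-nonNeg (λ c → ℚₚ.0≤∣p∣ (y c))) (ℚₚ.positive⁻¹ 1ℚ))
    instance
      M-pos : Positive M
      M-pos = positive 0<M
      M-nonZero : NonZero M
      M-nonZero = ℚₚ.pos⇒nonZero M
    e = 1/ M
    instance
      e-pos : Positive e
      e-pos = ℚₚ.1/pos⇒pos M
      e-nonNeg : NonNegative e
      e-nonNeg = ℚₚ.pos⇒nonNeg e
    ∣y∣≤M : ∀ c → ∣ y c ∣ ≤ M
    ∣y∣≤M c = ℚₚ.≤-trans (term≤sumℚ (λ c → ℚₚ.0≤∣p∣ (y c)) c)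
      (subst (_≤ M) (ℚₚ.+-identityˡ s) (ℚₚ.+-monoˡ-≤ s (from-yes (0ℚ ≤? 1ℚ))))
    hi : ∀ c → e * y c ≤ 1ℚ
    hi c = subst (e * y c ≤_) (ℚₚ.*-inverseˡ M)
      (ℚₚ.*-monoˡ-≤-nonNeg e (ℚₚ.≤-trans (p≤∣p∣ (y c)) (∣y∣≤M c)))
    lo : ∀ c → - 1ℚ ≤ e * y c
    lo c = subst (_≤ e * y c) (trans (sym (ℚₚ.neg-distribʳ-* e M)) (cong -_ (ℚₚ.*-inverseˡ M)))
      (ℚₚ.*-monoˡ-≤-nonNeg e (ℚₚ.≤-trans (ℚₚ.neg-antimono-≤ (∣y∣≤M c)) (-∣p∣≤p (y c))))


open Points

-- The space of equal line sums, the relative interior of the polytope, and the edge hyperplanes.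

module Geometry {d k : ℕ} (L : MCC d k) where

  open import Data.Rational using (_+_; _*_; -_; _-_; _≤_; _<_; _≤?_; _<?_)

  InS-cong : ∀ {x y : Pt d} → (∀ c → x c ≡ y c) → InS L x → InS L y
  InS-cong e h i {ℓ} {ℓ′} ℓ∈ ℓ′∈ =
    trans (sym (lineSum-cong e ℓ)) (trans (h i ℓ∈ ℓ′∈) (lineSum-cong e ℓ′))

  InS-comb : ∀ p q {x y : Pt d} → InS L x → InS L y → InS L (comb p x q y)
  InS-comb p q {x} {y} hx hy i {ℓ} {ℓ′} ℓ∈ ℓ′∈ = trans (lineSum-comb p x q y ℓ)
    (trans (cong₂ (λ a b → p * a + q * b) (hx i ℓ∈ ℓ′∈) (hy i ℓ∈ ℓ′∈)) (sym (lineSum-comb p x q y ℓ′)))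

  -- A constant has line sum equal to a multiple depending only on the size of the line; equal line
  -- sizes enter here.
  InS-const : AllLinesSameSize L → ∀ p → InS L (λ _ → p)
  InS-const (r , h) p i {ℓ} {ℓ′} ℓ∈ ℓ′∈ = lineSum-const p ℓ ℓ′ (trans (h i ℓ∈) (sym (h i ℓ′∈)))

  -- Extending any segment of the unit box by a quarter beyond `x` keeps each coordinate between
  -- 1/16 and 15/16.
  InPo-middle : ∀ {x} → InS L x → (∀ c → ¼ ≤ x c × x c ≤ ¾) → InPo L x
  InPo-middle {x} hx mid =
    (hx , λ c → ℚₚ.≤-trans (from-yes (0ℚ ≤? ¼)) (proj₁ (mid c)) ,
                ℚₚ.≤-trans (proj₂ (mid c)) (from-yes (¾ ≤? 1ℚ))) ,
    λ { y (hy , box) → ¼ , 0<¼ ,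
      InS-cong (λ c → extrapolate ¼ (x c) (y c)) (InS-comb (1ℚ + ¼) (- ¼) hx hy) ,
      λ c → ℚₚ.≤-trans (from-yes (0ℚ ≤? ¼ + ¼ * (¼ - 1ℚ)))
                       (extrapolate-mono 0<¼ (proj₁ (mid c)) (proj₂ (box c))) ,
            ℚₚ.≤-trans (extrapolate-mono 0<¼ (proj₂ (mid c)) (proj₁ (box c)))
                       (from-yes (¾ + ¼ * (¾ - 0ℚ) ≤? 1ℚ)) }

  module _ (same : AllLinesSameSize L) where

    centre : Pt d
    centre _ = ½

    centre-InPo : InPo L centre
    centre-InPo = InPo-middle (InS-const same ½) (λ _ → from-yes (¼ ≤? ½) , from-yes (½ ≤? ¾))

    -- Scaling by a small positive factor and translating to the centre brings `y` into the middle
    -- box, and an injective affine map on coordinates keeps exactly the same equalities.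
    shrink : ∀ {y} → InS L y → ∃ λ w → InPo L w × (∀ a b → w a ≡ w b ⇔ y a ≡ y b)
    shrink {y} hy with e , 0<e , lo , hi ← bounded-multiple y =
      w e , InPo-middle (InS-comb 1ℚ (¼ * e) (InS-const same ½) hy)
              (λ c → ℚₚ.≤-trans (from-yes (¼ ≤? 1ℚ * ½ + ¼ * (- 1ℚ))) (value e c (affine-mono (1ℚ * ½) 0<¼ (lo c))) ,
                     ℚₚ.≤-trans (value′ e c (affine-mono (1ℚ * ½) 0<¼ (hi c))) (from-yes (1ℚ * ½ + ¼ * 1ℚ ≤? ¾))) ,
      λ a b → mk⇔ (affine-injective (1ℚ * ½) (*-pos 0<¼ 0<e)) (cong (λ z → 1ℚ * ½ + (¼ * e) * z))
      where
      w : ℚ → Pt d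
      w e = comb 1ℚ centre (¼ * e) y
      value : ∀ {u} e c → u ≤ 1ℚ * ½ + ¼ * (e * y c) → u ≤ w e c
      value {u} e c = subst (λ a → u ≤ 1ℚ * ½ + a) (sym (ℚₚ.*-assoc ¼ e (y c)))
      value′ : ∀ {u} e c → 1ℚ * ½ + ¼ * (e * y c) ≤ u → w e c ≤ u
      value′ {u} e c = subst (λ a → 1ℚ * ½ + a ≤ u) (sym (ℚₚ.*-assoc ¼ e (y c)))

    -- Each point of a flat has a shrunken copy in the relative interior, satisfying the same
    -- equations, so inclusions can be tested there.
    InU⊆⇒InFlat⊆ : ∀ S S′ → SubSet (InU L S) (InU L S′) → SubSet (InFlat L S) (InFlat L S′)
    InU⊆⇒InFlat⊆ S S′ h y (hy , eqs) = hy , transfer (shrink hy)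
      where
      transfer : (∃ λ w → InPo L w × (∀ a b → w a ≡ w b ⇔ y a ≡ y b)) →
                 All (λ e → y (proj₁ e) ≡ y (proj₂ e)) S′
      transfer (w , w∈ , w⇔y) = All.map (λ {e} → to (w⇔y (proj₁ e) (proj₂ e)))
        (proj₂ (h w (w∈ , All.map (λ {e} → from (w⇔y (proj₁ e) (proj₂ e))) eqs)))

  Edge : Set
  Edge = Σ (Fin d × Fin d) (InH L)

  -- Its kernel is the edge hyperplane, and its positive side corresponds to the arrow from the
  -- smaller index `a` to `b`.
  difference : Edge → Pt d → ℚ
  difference ((a , b) , _) y = y b - y a

  difference-comb : ∀ f p x q y → difference f (comb p x q y) ≡ p * difference f x + q * difference f y
  difference-comb ((a , b) , _) p x q y = distrib-comb p (x a) (x b) q (y a) (y b)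

  open Arrangement comb difference difference-comb public

  space : Subspace
  Subspace._∋_ space    = InS L
  Subspace.closed space = InS-comb

  ker⇔InFlat : ∀ B {y} → InFlat L (map proj₁ B) y ⇔ (InS L y × ker B y)
  ker⇔InFlat B = mk⇔ (λ { (hy , eqs) → hy , All.map (λ {f} → p≡q⇒q-p≡0) (Allₚ.map⁻ eqs) })
                     (λ { (hy , eqs) → hy , Allₚ.map⁺ (All.map (λ {f} → q-p≡0⇒p≡q) eqs) })

  -- The latin labelling lies in the space and separates `a` from `b`, so the hyperplane does not
  -- contain the space.
  edge : LatinExists L → ∀ {a b} → a Fin.< b → Collinear L a b → InH L (a , b)
  edge (x , x∈ , distinct) {a} {b} a<b col = a<b , col , ℤtoℚ ∘ x , x∈ , distinct a b col ∘ ℤtoℚ-injective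

  -- Membership is asked for some proof component only, because a proof of `InH` carries a chosen
  -- point.
  Complete : List Edge → Set
  Complete A = ∀ {a b} → a Fin.< b → Collinear L a b → ∃ λ h → ((a , b) , h) ∈ A

  edges : LatinExists L → (∀ a b → Dec (Collinear L a b)) → ∃ Complete
  edges latin col? = collect pairs , λ {a} {b} a<b col →
    collected a<b col pairs (∈-cartesianProduct⁺ (∈-allFin a) (∈-allFin b))
    where
    pairs = cartesianProduct (allFin d) (allFin d)
    collect : List (Fin d × Fin d) → List Edge
    collect []             = []
    collect ((a , b) ∷ es) with a Finₚ.<? b | col? a b
    ... | yes a<b | yes col = ((a , b) , edge latin a<b col) ∷ collect es
    ... | yes _   | no _    = collect es
    ... | no _    | _       = collect es
    collected : ∀ {a b} → a Fin.< b → Collinear L a b → ∀ es → (a , b) ∈ es → ∃ λ h → ((a , b) , h) ∈ collect es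
    collected {a} {b} a<b col (_ ∷ es) (here refl) with a Finₚ.<? b | col? a b
    ... | yes a<b | yes col = _ , here refl
    ... | yes _   | no ¬col = contradiction col ¬col
    ... | no a≮b  | _       = contradiction a<b a≮b
    collected a<b col ((a′ , b′) ∷ es) (there e∈) with a′ Finₚ.<? b′ | col? a′ b′
    ... | yes _ | yes _ = let (h , ∈es) = collected a<b col es e∈ in h , there ∈es
    ... | yes _ | no _  = collected a<b col es e∈
    ... | no _  | _     = collected a<b col es e∈

  -- Orientations of the collinearity graph as sign vectors.

  signature : (A : List Edge) → Orientation d → Vec Bool (length A)
  signature []                  O = []
  signature (((a , b) , _) ∷ A) O = lookup (lookup O a) b ∷ signature A O

  signature-injective : ∀ A {O O′} → signature A O ≡ signature A O′ →
                        ∀ {f} → f ∈ A → lookup (lookup O (proj₁ (proj₁ f))) (proj₂ (proj₁ f))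
                                      ≡ lookup (lookup O′ (proj₁ (proj₁ f))) (proj₂ (proj₁ f))
  signature-injective (_ ∷ A) e (here refl) = Vecₚ.∷-injectiveˡ e
  signature-injective (_ ∷ A) e (there f∈)  = signature-injective A (Vecₚ.∷-injectiveʳ e) f∈

  signature-positive : ∀ A {O y} → IsOrientation L O → (∀ a b → Arrow O a b → y a < y b) →
                       Positive-on A (signature A O) y
  signature-positive []                        or h = tt
  signature-positive (((a , b) , _ , col , _) ∷ A) {O} {y} or h =
    head (lookup (lookup O a) b) refl (proj₂ or a b col) , signature-positive A or h
    where
    head : ∀ v → lookup (lookup O a) b ≡ v → (Arrow O a b × ¬ Arrow O b a) ⊎ (Arrow O b a × ¬ Arrow O a b) →
           0ℚ < signed v (y b - y a)
    head true  e _                 = p<q⇒0<q-p (h a b e)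
    head false e (inj₁ (a→b , _)) = contradiction (trans (sym e) a→b) λ ()
    head false e (inj₂ (b→a , _)) = subst (0ℚ <_) (sym (-[q-p]≡p-q (y a) (y b))) (p<q⇒0<q-p (h b a b→a))

  signature-compatible : ∀ A {O x} → IsOrientation L O → (∀ a b → Arrow O a b → x a ≤ x b) →
                         Compatible A (signature A O) x
  signature-compatible []                        or h = tt
  signature-compatible (((a , b) , _ , col , _) ∷ A) {O} {x} or h =
    head (lookup (lookup O a) b) refl (proj₂ or a b col) , signature-compatible A or h
    where
    head : ∀ v → lookup (lookup O a) b ≡ v → (Arrow O a b × ¬ Arrow O b a) ⊎ (Arrow O b a × ¬ Arrow O a b) →
           0ℚ ≤ signed v (x b - x a)
    head true  e _                 = p≤q⇒0≤q-p (h a b e)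
    head false e (inj₁ (a→b , _)) = contradiction (trans (sym e) a→b) λ ()
    head false e (inj₂ (b→a , _)) = subst (0ℚ ≤_) (sym (-[q-p]≡p-q (x a) (x b))) (p≤q⇒0≤q-p (h b a b→a))

  signed-unique : ∀ b c {q} → 0ℚ < signed b q → 0ℚ < signed c q → b ≡ c
  signed-unique true  true  _ _ = refl
  signed-unique false false _ _ = refl
  signed-unique true  false h h′ = contradiction (ℚₚ.<-trans h (neg-neg h′)) (ℚₚ.<-irrefl refl)
  signed-unique false true  h h′ = contradiction (ℚₚ.<-trans h′ (neg-neg h)) (ℚₚ.<-irrefl refl)

  positive-unique : ∀ A σ τ {y} → Positive-on A σ y → Positive-on A τ y → σ ≡ τ
  positive-unique []      []      []      _        _        = refl
  positive-unique (f ∷ A) (b ∷ σ) (c ∷ τ) {y} (h , hs) (h′ , hs′) =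
    cong₂ _∷_ (signed-unique b c {difference f y} h h′) (positive-unique A σ τ hs hs′)

  positive-∈ : ∀ A σ {x y} → Positive-on A σ y → Compatible A σ x → ∀ {f} → f ∈ A →
               ∃ λ v → 0ℚ < signed v (difference f y) × 0ℚ ≤ signed v (difference f x)
  positive-∈ (_ ∷ A) (b ∷ σ) (h , _)  (c , _)  (here refl) = b , h , c
  positive-∈ (_ ∷ A) (b ∷ σ) (_ , hs) (_ , cs) (there f∈)  = positive-∈ A σ hs cs f∈

  signed-swap : ∀ v p q → signed v (q - p) ≡ signed (not v) (p - q)
  signed-swap true  p q = sym (-[q-p]≡p-q q p)
  signed-swap false p q = -[q-p]≡p-q p q

  -- The list holds each edge with its smaller endpoint first; for the other order both signs are
  -- flipped.
  positive-collinear : ∀ {A} → Complete A → ∀ σ {x y} → Positive-on A σ y → Compatible A σ x →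
    ∀ {a b} → Collinear L a b → ∃ λ v → 0ℚ < signed v (y b - y a) × 0ℚ ≤ signed v (x b - x a)
  positive-collinear {A} complete σ {x} {y} h c {a} {b} col@(a≢b , i , ℓ , ℓ∈ , a∈ , b∈)
    with Finₚ.<-cmp a b
  ... | tri< a<b _ _ = positive-∈ A σ h c (proj₂ (complete a<b col))
  ... | tri≈ _ a≡b _ = contradiction a≡b a≢b
  ... | tri> _ _ b<a with v , hv , cv ← positive-∈ A σ h c (proj₂ (complete b<a (a≢b ∘ sym , i , ℓ , ℓ∈ , b∈ , a∈))) =
    not v , subst (0ℚ <_) (signed-swap v (y b) (y a)) hv , subst (0ℚ ≤_) (signed-swap v (x b) (x a)) cv

  module _ (col? : ∀ a b → Dec (Collinear L a b)) where

    orient : Pt d → Orientation d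
    orient y = Vec.tabulate λ a → Vec.tabulate λ b → does (col? a b ×-dec (y a <? y b))

    lookup-orient : ∀ y a b → lookup (lookup (orient y) a) b ≡ does (col? a b ×-dec (y a <? y b))
    lookup-orient y a b = trans (cong (λ r → lookup r b) (Vecₚ.lookup∘tabulate _ a)) (Vecₚ.lookup∘tabulate _ b)

    Arrow-orient : ∀ y a b → Arrow (orient y) a b ⇔ (Collinear L a b × y a < y b)
    Arrow-orient y a b = mk⇔ (λ e → witness (col? a b ×-dec (y a <? y b)) (trans (sym (lookup-orient y a b)) e))
      (λ h → trans (lookup-orient y a b) (dec-true (col? a b ×-dec (y a <? y b)) h))
      where
      witness : {P : Set} (p? : Dec P) → does p? ≡ true → P
      witness (yes p) _ = p

    orient-IsOrientation : ∀ {y} → (∀ a b → Collinear L a b → y a ≢ y b) → IsOrientation L (orient y)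
    orient-IsOrientation {y} distinct = (λ a b e → proj₁ (to (Arrow-orient y a b) e)) , either
      where
      either : ∀ a b → Collinear L a b → (Arrow (orient y) a b × ¬ Arrow (orient y) b a)
                                       ⊎ (Arrow (orient y) b a × ¬ Arrow (orient y) a b)
      either a b col@(a≢b , i , ℓ , ℓ∈ , a∈ , b∈) with ℚₚ.<-cmp (y a) (y b)
      ... | tri< a<b _ b≮a = inj₁ (from (Arrow-orient y a b) (col , a<b) , b≮a ∘ proj₂ ∘ to (Arrow-orient y b a))
      ... | tri≈ _ a≡b _   = contradiction a≡b (distinct a b col)
      ... | tri> a≮b _ b<a = inj₂ (from (Arrow-orient y b a) ((a≢b ∘ sym , i , ℓ , ℓ∈ , b∈ , a∈) , b<a) ,
                                   a≮b ∘ proj₂ ∘ to (Arrow-orient y a b))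

  -- Coordinates rise strictly along a directed path, so a cycle would put a coordinate below
  -- itself.
  increasing⇒Acyclic : ∀ {O : Orientation d} {y : Pt d} → (∀ a b → Arrow O a b → y a < y b) → Acyclic O
  increasing⇒Acyclic {O} {y} h a path = ℚₚ.<-irrefl refl (climb path)
    where
    climb : ∀ {a b} → TransClosure (Arrow O) a b → y a < y b
    climb [ e ]      = h _ _ e
    climb (e ∷ path) = ℚₚ.<-trans (h _ _ e) (climb path)

  -- The signature fixes the entries of collinear pairs in increasing order; antisymmetry gives the
  -- reversed pairs, and all other entries are `false`.
  signature-determines : ∀ {A} → Complete A → (∀ a b → Dec (Collinear L a b)) → ∀ {O O′} →
    IsOrientation L O → IsOrientation L O′ → signature A O ≡ signature A O′ → O ≡ O′
  signature-determines {A} complete col? {O} {O′} or or′ e =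
    ext (λ a → ext (λ b → entry a b))
    where
    ext : ∀ {B : Set} {m} {u v : Vec B m} → (∀ i → lookup u i ≡ lookup v i) → u ≡ v
    ext {u = u} {v} h = trans (sym (Vecₚ.tabulate∘lookup u)) (trans (Vecₚ.tabulate-cong h) (Vecₚ.tabulate∘lookup v))
    opposite : ∀ O → IsOrientation L O → ∀ a b → Collinear L a b →
               lookup (lookup O a) b ≡ not (lookup (lookup O b) a)
    opposite O or a b col with lookup (lookup O a) b | lookup (lookup O b) a | proj₂ or a b col
    ... | true  | false | _                = refl
    ... | false | true  | _                = refl
    ... | true  | true  | inj₁ (_ , ¬b→a) = contradiction refl ¬b→a
    ... | true  | true  | inj₂ (_ , ¬a→b) = contradiction refl ¬a→b
    ... | false | false | inj₁ (() , _)
    ... | false | false | inj₂ (() , _)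
    absent : ∀ O → IsOrientation L O → ∀ a b → ¬ Collinear L a b → lookup (lookup O a) b ≡ false
    absent O or a b ¬col with lookup (lookup O a) b in eq
    ... | true  = contradiction (proj₁ or a b eq) ¬col
    ... | false = refl
    entry : ∀ a b → lookup (lookup O a) b ≡ lookup (lookup O′ a) b
    entry a b with col? a b
    ... | no ¬col = trans (absent O or a b ¬col) (sym (absent O′ or′ a b ¬col))
    ... | yes col@(a≢b , i , ℓ , ℓ∈ , a∈ , b∈) with Finₚ.<-cmp a b
    ...   | tri< a<b _ _ = signature-injective A e (proj₂ (complete a<b col))
    ...   | tri≈ _ a≡b _ = contradiction a≡b a≢b
    ...   | tri> _ _ b<a = trans (opposite O or a b col) (trans
            (cong not (signature-injective A e (proj₂ (complete b<a (a≢b ∘ sym , i , ℓ , ℓ∈ , b∈ , a∈)))))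
            (sym (opposite O′ or′ a b col)))

-- Sums grouped by the value of an index.

open import Data.Nat using (_≤_)
open import Data.Integer using (_*_; ∣_∣)

∑-fibres : ∀ {A : Set} {n} (index : A → Fin n) (w : A → ℤ) (g : Fin n → ℤ) xs →
           ∑ (allFin n) (λ i → ∑ xs (λ x → 𝟙 (index x Finₚ.≟ i) * w x) * g i) ≡ ∑ xs (λ x → w x * g (index x))
∑-fibres {n = n} index w g xs = begin
  ∑ (allFin n) (λ i → ∑ xs (λ x → 𝟙 (index x Finₚ.≟ i) * w x) * g i)
    ≡⟨ ∑-cong (allFin n) (λ i → sym (∑-*ʳ (g i) (λ x → 𝟙 (index x Finₚ.≟ i) * w x) xs)) ⟩
  ∑ (allFin n) (λ i → ∑ xs (λ x → 𝟙 (index x Finₚ.≟ i) * w x * g i))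
    ≡⟨ ∑-swap (λ i x → 𝟙 (index x Finₚ.≟ i) * w x * g i) (allFin n) xs ⟩
  ∑ xs (λ x → ∑ (allFin n) (λ i → 𝟙 (index x Finₚ.≟ i) * w x * g i))
    ≡⟨ ∑-cong xs (λ x → trans
         (∑-cong (allFin n) (λ i → ℤₚ.*-assoc (𝟙 (index x Finₚ.≟ i)) (w x) (g i)))
         (∑-δ Finₚ._≟_ (λ i → w x * g i) (Uniqueₚ.allFin⁺ n) (∈-allFin (index x)))) ⟩
  ∑ xs (λ x → w x * g (index x)) ∎
  where open ≡-Reasoning

∣sgn∣ : ∀ m → ∣ sgn m ∣ ≡ 1
∣sgn∣ zero    = refl
∣sgn∣ (suc m) = trans (ℤₚ.∣-i∣≡∣i∣ (sgn m)) (∣sgn∣ m)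

-- Elements of one fibre have equal size, so all their signs agree and nothing cancels.
∣∑-fibre∣ : ∀ {A : Set} {P : A → Set} (P? : ∀ x → Dec (P x)) (size : A → ℕ) xs →
            (∀ {x y} → x ∈ xs → y ∈ xs → P x → P y → size x ≡ size y) →
            + ∣ ∑ xs (λ x → 𝟙 (P? x) * sgn (size x)) ∣ ≡ ∑ xs (λ x → 𝟙 (P? x) * + 1)
∣∑-fibre∣ {P = P} P? size xs same = trans (cong (+_ ∘ ∣_∣) signed-count) (trans (cong +_ (begin
  ∣ sgn m * + length (filter P? xs) ∣            ≡⟨ ℤₚ.abs-* (sgn m) _ ⟩
  ∣ sgn m ∣ ℕ.* length (filter P? xs)            ≡⟨ cong (ℕ._* length (filter P? xs)) (∣sgn∣ m) ⟩
  1 ℕ.* length (filter P? xs)                    ≡⟨ ℕₚ.*-identityˡ _ ⟩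
  length (filter P? xs)                          ∎))
  (trans (length-filter-∑ P? xs) (∑-cong xs (λ x → sym (ℤₚ.*-identityʳ (𝟙 (P? x)))))))
  where
  open ≡-Reasoning
  common : ∃ λ m → ∀ {x} → x ∈ xs → P x → size x ≡ m
  common with Any.any? P? xs
  ... | yes any = let (x₀ , x₀∈ , p₀) = find any in size x₀ , λ x∈ p → same x∈ x₀∈ p p₀
  -- For an empty fibre both sides are zero and 0 is a dummy size.
  ... | no none = 0 , λ x∈ p → contradiction (Any.map (λ { refl → p }) x∈) none
  m : ℕ
  m = proj₁ common
  term : ∀ {x} → x ∈ xs → 𝟙 (P? x) * sgn (size x) ≡ sgn m * 𝟙 (P? x)
  term {x} x∈ with P? x
  ... | yes p = trans (ℤₚ.*-comm (+ 1) (sgn (size x))) (cong (λ l → sgn l * + 1) (proj₂ common x∈ p))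
  ... | no _  = sym (ℤₚ.*-zeroʳ (sgn m))
  signed-count : ∑ xs (λ x → 𝟙 (P? x) * sgn (size x)) ≡ sgn m * + length (filter P? xs)
  signed-count = trans (∑-cong-∈ xs term) (trans (∑-*ˡ (sgn m) (𝟙 ∘ P?) xs)
                       (cong (sgn m *_) (sym (length-filter-∑ P? xs))))

¬¬-Fin : ∀ {n} {P : Fin n → Set} → (∀ i → ¬ ¬ P i) → ¬ ¬ (∀ i → P i)
¬¬-Fin {zero}  h k = k λ ()
¬¬-Fin {suc n} h k = h zero λ p → ¬¬-Fin (h ∘ suc) λ ps → k λ { zero → p ; (suc i) → ps i }

-- The intersection lattice, its Möbius function and the point counts.

module Lattice {d k : ℕ} (L : MCC d k) (same : AllLinesSameSize L)
  {n : ℕ} (reps : Vec (List (Fin d × Fin d)) n) (isReps : IsLatticeReps L reps) where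

  open Geometry L

  rep : Fin n → List (Fin d × Fin d)
  rep = lookup reps

  -- The centre satisfies every edge equation, so every set of edges has a nonempty trace and names
  -- a lattice element.
  representative : ∀ B → ∃ λ i → SameSet (InU L (map proj₁ B)) (InU L (rep i))
  representative B = proj₁ (proj₂ isReps) (map proj₁ B) (Allₚ.map⁺ (All.tabulate (λ {f} _ → proj₂ f)))
    (centre same , centre-InPo same , All.tabulate (λ _ → refl))

  index : List Edge → Fin n
  index B = proj₁ (representative B)

  -- The representative may be another edge set, but equal traces on the relative interior force
  -- equal flats.
  index-flat : ∀ B {y} → InFlat L (rep (index B)) y ⇔ (InS L y × ker B y)
  index-flat B {y} = mk⇔
    (λ h → to (ker⇔InFlat B) (InU⊆⇒InFlat⊆ same (rep (index B)) (map proj₁ B)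
             (λ z → from (proj₂ (representative B) z)) y h))
    (λ h → InU⊆⇒InFlat⊆ same (map proj₁ B) (rep (index B))
             (λ z → to (proj₂ (representative B) z)) y (from (ker⇔InFlat B) h))

  Bottom : Fin n → Set
  Bottom i = SameSet (InU L (rep i)) (InPo L)

  module _ {A : List Edge} (T : Decided space A) where

    -- This is the candidate for the Möbius function from the bottom element.
    ν : Fin n → ℤ
    ν i = ∑ (nbc T) (λ B → 𝟙 (index B Finₚ.≟ i) * sgn (length B))

    ∣ν∣ : ∀ i → + ∣ ν i ∣ ≡ ∑ (nbc T) (λ B → 𝟙 (index B Finₚ.≟ i) * + 1)
    ∣ν∣ i = ∣∑-fibre∣ (λ B → index B Finₚ.≟ i) length (nbc T) λ {B} {C} B∈ C∈ B≡i C≡i →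
      flags-same-length space B C (All.lookup (nbc-flags T) B∈) (All.lookup (nbc-flags T) C∈)
        (λ y∈ → mk⇔ (transfer B C (trans B≡i (sym C≡i)) y∈) (transfer C B (trans C≡i (sym B≡i)) y∈))
      where
      transfer : ∀ B C → index B ≡ index C → ∀ {y} → InS L y → ker B y → ker C y
      transfer B C e {y} y∈ kB =
        proj₂ (to (index-flat C) (subst (λ j → InFlat L (rep j) y) e (from (index-flat B) (y∈ , kB))))

  module _ {A : List Edge} (complete : Complete A) (T : Decided space A) where

    -- Each edge of a representative vanishes on its own flat, so if no edge vanishes the
    -- representative is empty. Conversely the bottom flat is the whole space, where each edge takes
    -- a nonzero value by definition of `InH`.
    bottom⇔ : ∀ i → All (λ f → ¬ Vanishes (InFlat L (rep i)) f) A ⇔ Bottom i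
    bottom⇔ i = mk⇔
      (λ h y → mk⇔ proj₁ (λ y∈ → y∈ , All.tabulate λ {e} e∈ →
        let (a<b , col , _) = All.lookup (proj₁ (proj₁ isReps i)) e∈
            (_ , f∈) = complete a<b col
        in contradiction (λ z z∈ → p≡q⇒q-p≡0 (All.lookup (proj₂ z∈) e∈)) (All.lookup h f∈)))
      (λ bot → All.tabulate λ { {(a , b) , _ , _ , y , y∈ , ya≢yb} _ van →
        ya≢yb (q-p≡0⇒p≡q (van y (InU⊆⇒InFlat⊆ same [] (rep i)
          (λ z z∈ → from (bot z) (proj₁ z∈)) y (y∈ , [])))) })

    module _ (le? : ∀ j i → Dec (LatLe L reps j i))
             (van? : ∀ i a b → Dec (∀ y → InFlat L (rep i) y → y a ≡ y b)) where

      vanishes? : ∀ i f → Dec (Vanishes (InFlat L (rep i)) f)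
      vanishes? i ((a , b) , _) = map′ (λ h y y∈ → p≡q⇒q-p≡0 (h y y∈)) (λ h y y∈ → q-p≡0⇒p≡q (h y y∈)) (van? i a b)

      le⇔vanishes : ∀ B i → LatLe L reps (index B) i ⇔ All (Vanishes (InFlat L (rep i))) B
      le⇔vanishes B i = mk⇔
        (λ le → All.tabulate λ f∈ y y∈ → All.lookup (proj₂ (to (index-flat B)
          (InU⊆⇒InFlat⊆ same (rep i) (rep (index B)) le y y∈))) f∈)
        (λ van y y∈ → proj₁ y∈ , proj₂ (from (index-flat B)
          (proj₁ (proj₁ (proj₁ y∈)) , All.map (λ v → v y (proj₁ (proj₁ (proj₁ y∈)) , proj₂ y∈)) van)))

      -- The elements below `i` collect the sets all of whose forms vanish on the flat of `i`, and
      -- `∑-nbc-sgn` is applied with that flat as `Y`.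
      ∑-ν-below : ∀ i → ∑ (allFin n) (λ j → 𝟙 (le? j i) * ν T j) ≡ 𝟙 (All.all? (¬? ∘ vanishes? i) A)
      ∑-ν-below i = begin
        ∑ (allFin n) (λ j → 𝟙 (le? j i) * ν T j)
          ≡⟨ ∑-cong (allFin n) (λ j → ℤₚ.*-comm (𝟙 (le? j i)) (ν T j)) ⟩
        ∑ (allFin n) (λ j → ν T j * 𝟙 (le? j i))
          ≡⟨ ∑-fibres index (sgn ∘ length) (λ j → 𝟙 (le? j i)) (nbc T) ⟩
        ∑ (nbc T) (λ B → sgn (length B) * 𝟙 (le? (index B) i))
          ≡⟨ ∑-cong (nbc T) (λ B → cong (sgn (length B) *_)
               (𝟙-cong (le⇔vanishes B i) (le? (index B) i) (All.all? (vanishes? i) B))) ⟩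
        ∑ (nbc T) (λ B → sgn (length B) * 𝟙 (All.all? (vanishes? i) B))
          ≡⟨ ∑-nbc-sgn T proj₁ (vanishes? i) ⟩
        𝟙 (All.all? (¬? ∘ vanishes? i) A) ∎
        where open ≡-Reasoning

      _⊏_ : Fin n → Fin n → Set
      j ⊏ i = LatLe L reps j i × j ≢ i

      _⊏?_ : ∀ j i → Dec (j ⊏ i)
      j ⊏? i = le? j i ×-dec ¬? (j Finₚ.≟ i)

      le-antisym : ∀ {i j} → LatLe L reps i j → LatLe L reps j i → i ≡ j
      le-antisym {i} {j} p q = proj₂ (proj₂ isReps) i j (λ y → mk⇔ (q y) (p y))

      ⊏-isStrictPartialOrder : IsStrictPartialOrder _≡_ _⊏_
      ⊏-isStrictPartialOrder = record
        { isEquivalence = isEquivalence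
        ; irrefl        = λ { refl (_ , i≢i) → i≢i refl }
        ; trans         = λ { (p , i≢j) (q , _) → (λ y y∈ → p y (q y y∈)) , λ { refl → i≢j (le-antisym p q) } }
        ; <-resp-≈      = (λ { refl h → h }) , (λ { refl h → h })
        }

      ∑-split : ∀ (g : Fin n → ℤ) i → ∑ (allFin n) (λ j → 𝟙 (le? j i) * g j)
                                    ≡ ∑ (allFin n) (λ j → 𝟙 (j ⊏? i) * g j) ℤ.+ g i
      ∑-split g i = begin
        ∑ (allFin n) (λ j → 𝟙 (le? j i) * g j)
          ≡⟨ ∑-cong (allFin n) (λ j → trans (cong (_* g j) (split j (i Finₚ.≟ j)))
               (ℤₚ.*-distribʳ-+ (g j) (𝟙 (j ⊏? i)) (𝟙 (i Finₚ.≟ j)))) ⟩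
        ∑ (allFin n) (λ j → 𝟙 (j ⊏? i) * g j ℤ.+ 𝟙 (i Finₚ.≟ j) * g j)
          ≡⟨ ∑-+ (λ j → 𝟙 (j ⊏? i) * g j) (λ j → 𝟙 (i Finₚ.≟ j) * g j) (allFin n) ⟩
        ∑ (allFin n) (λ j → 𝟙 (j ⊏? i) * g j) ℤ.+ ∑ (allFin n) (λ j → 𝟙 (i Finₚ.≟ j) * g j)
          ≡⟨ cong (ℤ._+_ (∑ (allFin n) (λ j → 𝟙 (j ⊏? i) * g j)))
               (∑-δ Finₚ._≟_ g (Uniqueₚ.allFin⁺ n) (∈-allFin i)) ⟩
        ∑ (allFin n) (λ j → 𝟙 (j ⊏? i) * g j) ℤ.+ g i ∎
        where
        open ≡-Reasoning
        split : ∀ j (i≟j : Dec (i ≡ j)) → 𝟙 (le? j i) ≡ 𝟙 (j ⊏? i) ℤ.+ 𝟙 i≟j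
        split j (yes refl) = trans (𝟙-yes (λ y y∈ → y∈) (le? i i))
                                   (sym (cong (ℤ._+ + 1) (𝟙-no (λ { (_ , i≢i) → i≢i refl }) (i ⊏? i))))
        split j (no i≢j)   = trans (𝟙-cong (mk⇔ (λ h → h , i≢j ∘ sym) proj₁) (le? j i) (j ⊏? i))
                                   (sym (ℤₚ.+-identityʳ _))

      -- The values of a Möbius function up to `i` sum to the indicator of the bottom element,
      -- rewritten by `bottom⇔` in the form that `∑-ν-below` gives for `ν`.
      μ-recursion : ∀ {μ} → IsMobiusFromBottom L reps μ → ∀ i →
        ∑ (allFin n) (λ j → 𝟙 (j ⊏? i) * μ j) ℤ.+ μ i ≡ 𝟙 (All.all? (¬? ∘ vanishes? i) A)
      μ-recursion {μ} isμ i = cases (All.all? (¬? ∘ vanishes? i) A)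
        where
        none : Bottom i → ∀ {j} → ¬ (j ⊏ i)
        none bot (le , j≢i) = j≢i (le-antisym le (λ y y∈ → from (bot y) (proj₁ y∈)))
        nonBottom : (∃ λ z → SumOver (_⊏ i) μ z × μ i ≡ ℤ.- z) →
                    ∑ (allFin n) (λ j → 𝟙 (j ⊏? i) * μ j) ℤ.+ μ i ≡ + 0
        nonBottom (z , s , μ≡-z) = trans
          (cong₂ ℤ._+_ (trans (sym (sumℤ-∑ (λ j → 𝟙 (j ⊏? i) * μ j))) (sym (SumOver⇒sumℤ (_⊏? i) μ s))) μ≡-z) (ℤₚ.+-inverseʳ z)
        cases : (h? : Dec (All (λ f → ¬ Vanishes (InFlat L (rep i)) f) A)) →
                ∑ (allFin n) (λ j → 𝟙 (j ⊏? i) * μ j) ℤ.+ μ i ≡ 𝟙 h?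
        cases (yes h) = cong₂ ℤ._+_
          (trans (∑-cong (allFin n) (λ j → cong (_* μ j) (𝟙-no (none (to (bottom⇔ i) h)) (j ⊏? i)))) (∑-zero (allFin n)))
          (proj₁ (isμ i) (to (bottom⇔ i) h))
        cases (no ¬h) = nonBottom (proj₂ (isμ i) (¬h ∘ from (bottom⇔ i)))

      -- Both functions obey the same recursion; well-founded induction identifies the terms
      -- strictly below `i`, which then cancel.
      μ≡ν : ∀ {μ} → IsMobiusFromBottom L reps μ → ∀ i → μ i ≡ ν T i
      μ≡ν {μ} isμ = WellFounded.All.wfRec (spo-wellFounded ⊏-isStrictPartialOrder) _ _ step
        where
        step : ∀ i → (∀ {j} → j ⊏ i → μ j ≡ ν T j) → μ i ≡ ν T i
        step i ih = ∙-cancelˡ ℤₚ.+-0-abelianGroup (∑ (allFin n) (λ j → 𝟙 (j ⊏? i) * ν T j)) _ _ (begin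
          ∑ (allFin n) (λ j → 𝟙 (j ⊏? i) * ν T j) ℤ.+ μ i
            ≡⟨ cong (ℤ._+ μ i) (∑-cong (allFin n) (λ j → below j (j ⊏? i))) ⟩
          ∑ (allFin n) (λ j → 𝟙 (j ⊏? i) * μ j) ℤ.+ μ i     ≡⟨ μ-recursion isμ i ⟩
          𝟙 (All.all? (¬? ∘ vanishes? i) A)                  ≡⟨ ∑-ν-below i ⟨
          ∑ (allFin n) (λ j → 𝟙 (le? j i) * ν T j)             ≡⟨ ∑-split (ν T) i ⟩
          ∑ (allFin n) (λ j → 𝟙 (j ⊏? i) * ν T j) ℤ.+ ν T i     ∎)
          where
          open ≡-Reasoning
          below : ∀ j → (lt : Dec (j ⊏ i)) → 𝟙 lt * ν T j ≡ 𝟙 lt * μ j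
          below j (yes lt) = cong (+ 1 *_) (sym (ih lt))
          below j (no _)   = refl

  module _ {Box : Vec ℕ d → Set} (E : Fin n → ℕ)
    (count : ∀ i → CountIs (λ x → Box x × InFlat L (rep i) (ptℕ x)) (E i)) where

    -- The empty edge set gives the bottom flat, so its enumeration lists all integer points of the
    -- space in the box.
    points : List (Vec ℕ d)
    points = proj₁ (count (index []))

    points-unique : Unique points
    points-unique = proj₁ (proj₂ (proj₂ (count (index []))))

    ∈-points : ∀ x → x ∈ points ⇔ (Box x × InS L (ptℕ x))
    ∈-points x = mk⇔
      (λ x∈ → let (b , h) = to (proj₂ (proj₂ (proj₂ (count (index [])))) x) x∈ in b , proj₁ h)
      (λ { (b , h) → from (proj₂ (proj₂ (proj₂ (count (index [])))) x) (b , from (index-flat []) (h , [])) })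

    E-index : ∀ B → + E (index B) ≡ ∑ points (λ x → 𝟙 (zeros? (ptℕ x) B))
    E-index B = CountIs⇒∑ (count (index B)) points-unique (λ x → zeros? (ptℕ x) B) λ x → mk⇔
      (λ { (b , h) → let (s , z) = to (index-flat B) h in from (∈-points x) (b , s) , z })
      (λ { (x∈ , z) → let (b , s) = to (∈-points x) x∈ in b , from (index-flat B) (s , z) })

    -- Double counting of incidences between points and flats, with the sets then grouped by lattice
    -- element.
    ∑-points-nbc : ∀ {A} (T : Decided space A) (w : List Edge → ℤ) →
      ∑ points (λ x → ∑ (nbc T) (λ B → w B * 𝟙 (zeros? (ptℕ x) B)))
      ≡ ∑ (allFin n) (λ i → ∑ (nbc T) (λ B → 𝟙 (index B Finₚ.≟ i) * w B) * + E i)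
    ∑-points-nbc T w = begin
      ∑ points (λ x → ∑ (nbc T) (λ B → w B * 𝟙 (zeros? (ptℕ x) B)))
        ≡⟨ ∑-swap (λ x B → w B * 𝟙 (zeros? (ptℕ x) B)) points (nbc T) ⟩
      ∑ (nbc T) (λ B → ∑ points (λ x → w B * 𝟙 (zeros? (ptℕ x) B)))
        ≡⟨ ∑-cong (nbc T) (λ B → trans (∑-*ˡ (w B) (λ x → 𝟙 (zeros? (ptℕ x) B)) points)
                                       (cong (w B *_) (sym (E-index B)))) ⟩
      ∑ (nbc T) (λ B → w B * + E (index B))
        ≡⟨ ∑-fibres index w (λ i → + E i) (nbc T) ⟨
      ∑ (allFin n) (λ i → ∑ (nbc T) (λ B → 𝟙 (index B Finₚ.≟ i) * w B) * + E i) ∎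
      where open ≡-Reasoning

    module _ {A : List Edge} (complete : Complete A) (T : Decided space A) where

      vanishes-at? : ∀ x f → Dec (Vanishes (_≡ x) f)
      vanishes-at? x f = map′ (λ { h y refl → h }) (λ h → h x refl) (difference f x ℚ.≟ 0ℚ)

      -- A point is a latin labelling exactly when no edge form vanishes at it; `∑-nbc-sgn` is used
      -- with the singleton of that point as `Y`.
      generic-count : ∀ {a} →
        CountIs (λ x → Box x × InS L (ptℕ x) × (∀ a b → Collinear L a b → lookup x a ≢ lookup x b)) a →
        + a ≡ ∑ (allFin n) (λ i → ν T i * + E i)
      generic-count {a} hyp = begin
        + a
          ≡⟨ CountIs⇒∑ hyp points-unique (λ x → All.all? (¬? ∘ vanishes-at? (ptℕ x)) A) (λ x → mk⇔
               (λ { (b , s , distinct) → from (∈-points x) (b , s) , All.tabulate λ { {(a , b) , _ , col , _} _ van →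
                    distinct a b col (ℤₚ.+-injective (ℤtoℚ-injective (q-p≡0⇒p≡q (van _ refl)))) } })
               (λ { (x∈ , h) → let (b , s) = to (∈-points x) x∈ in b , s , off x h })) ⟩
        ∑ points (λ x → 𝟙 (All.all? (¬? ∘ vanishes-at? (ptℕ x)) A))
          ≡⟨ ∑-cong-∈ points (λ {x} x∈ → sym (∑-nbc-sgn T
               (λ { refl → proj₂ (to (∈-points x) x∈) }) (vanishes-at? (ptℕ x)))) ⟩
        ∑ points (λ x → ∑ (nbc T) (λ B → sgn (length B) * 𝟙 (All.all? (vanishes-at? (ptℕ x)) B)))
          ≡⟨ ∑-cong points (λ x → ∑-cong (nbc T) (λ B → cong (sgn (length B) *_)
               (𝟙-cong (mk⇔ (All.map (λ h → h _ refl)) (All.map (λ { h y refl → h })))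
                       (All.all? (vanishes-at? (ptℕ x)) B) (zeros? (ptℕ x) B)))) ⟩
        ∑ points (λ x → ∑ (nbc T) (λ B → sgn (length B) * 𝟙 (zeros? (ptℕ x) B)))
          ≡⟨ ∑-points-nbc T (sgn ∘ length) ⟩
        ∑ (allFin n) (λ i → ν T i * + E i) ∎
        where
        open ≡-Reasoning
        off : ∀ x → All (λ f → ¬ Vanishes (_≡ ptℕ x) f) A → ∀ a b → Collinear L a b → lookup x a ≢ lookup x b
        off x h a b col@(a≢b , i , ℓ , ℓ∈ , a∈ , b∈) eq with Finₚ.<-cmp a b
        ... | tri< a<b _ _ = All.lookup h (proj₂ (complete a<b col)) λ { _ refl → p≡q⇒q-p≡0 (cong (λ m → ℤtoℚ (+ m)) eq) }
        ... | tri≈ _ a≡b _ = a≢b a≡b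
        ... | tri> _ _ b<a = All.lookup h (proj₂ (complete b<a (a≢b ∘ sym , i , ℓ , ℓ∈ , b∈ , a∈)))
                               λ { _ refl → p≡q⇒q-p≡0 (cong (λ m → ℤtoℚ (+ m)) (sym eq)) }

      Pair : Vec ℕ d × Orientation d → Set
      Pair (x , O) = Box x × InS L (ptℕ x) × IsOrientation L O × Acyclic O × CompatibleWith O x × RealizableIn L O

      SignPair : Vec ℕ d × Vec Bool (length A) → Set
      SignPair (x , σ) = x ∈ points × Region space A (ptℕ x) σ

      -- Compatible realizable orientations correspond, via their signatures, to the regions whose
      -- closure contains `x`, and `∑-regions` counts these.
      pair-count : (∀ a b → Dec (Collinear L a b)) → ∀ {b} → CountIs Pair b →
        + b ≡ ∑ (allFin n) (λ i → + ∣ ν T i ∣ * + E i)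
      pair-count col? {b} hyp = begin
        + b
          ≡⟨ CountIs⇒∑ (CountIs-map sign injective sound surjective hyp)
               (Uniqueₚ.cartesianProduct⁺ points-unique (signs-unique (length A)))
               (λ { (x , σ) → region? T (ptℕ x) σ })
               (λ { (x , σ) → mk⇔ (λ { (x∈ , r) → ∈-cartesianProduct⁺ x∈ (∈-signs σ) , r })
                                  (λ { (xσ∈ , r) → proj₁ (∈-cartesianProduct⁻ points _ xσ∈) , r }) }) ⟩
        ∑ (cartesianProduct points (signs (length A))) (λ { (x , σ) → 𝟙 (region? T (ptℕ x) σ) })
          ≡⟨ ∑-cartesianProduct _ points (signs (length A)) ⟩
        ∑ points (λ x → ∑ (signs (length A)) (λ σ → 𝟙 (region? T (ptℕ x) σ)))
          ≡⟨ ∑-cong-∈ points (λ {x} x∈ → trans (∑-regions T (proj₂ (to (∈-points x) x∈)))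
               (∑-cong (nbc T) (λ B → sym (ℤₚ.*-identityˡ (𝟙 (zeros? (ptℕ x) B)))))) ⟩
        ∑ points (λ x → ∑ (nbc T) (λ B → + 1 * 𝟙 (zeros? (ptℕ x) B)))
          ≡⟨ ∑-points-nbc T (λ _ → + 1) ⟩
        ∑ (allFin n) (λ i → ∑ (nbc T) (λ B → 𝟙 (index B Finₚ.≟ i) * + 1) * + E i)
          ≡⟨ ∑-cong (allFin n) (λ i → cong (_* + E i) (∣ν∣ T i)) ⟨
        ∑ (allFin n) (λ i → + ∣ ν T i ∣ * + E i) ∎
        where
        open ≡-Reasoning
        sign : Vec ℕ d × Orientation d → Vec ℕ d × Vec Bool (length A)
        sign (x , O) = x , signature A O
        injective : ∀ {p q} → Pair p → Pair q → sign p ≡ sign q → p ≡ q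
        injective (_ , _ , or , _) (_ , _ , or′ , _) e =
          cong₂ _,_ (cong proj₁ e) (signature-determines complete col? or or′ (cong proj₂ e))
        sound : ∀ {p} → Pair p → SignPair (sign p)
        sound {x , O} (box , s , or , _ , compatible , y , y∈ , h) = from (∈-points x) (box , s) ,
          (y , y∈ , signature-positive A or h) ,
          signature-compatible A or (λ a b e → ℤtoℚ-mono-≤ (ℤ.+≤+ (compatible a b e)))
        surjective : ∀ {p} → SignPair p → ∃ λ q → Pair q × p ≡ sign q
        surjective {x , σ} (x∈ , (y , y∈ , pos) , compatible) =
          (x , O) , (proj₁ (to (∈-points x) x∈) , proj₂ (to (∈-points x) x∈) , or ,
                     increasing⇒Acyclic {O} {y} increasing , weakly , y , y∈ , increasing) ,
          cong (x ,_) (positive-unique A σ (signature A O) pos (signature-positive A or increasing))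
          where
          -- The orientation is read off from a point of the open cell, so realizability and
          -- acyclicity come with it.
          O = orient col? y
          increasing : ∀ a b → Arrow O a b → y a ℚ.< y b
          increasing a b e = proj₂ (to (Arrow-orient col? y a b) e)
          both : ∀ {a b} → Collinear L a b →
                 ∃ λ v → 0ℚ ℚ.< signed v (y b ℚ.- y a) × 0ℚ ℚ.≤ signed v (ptℕ x b ℚ.- ptℕ x a)
          both = positive-collinear complete σ pos compatible
          or : IsOrientation L O
          or = orient-IsOrientation col? {y} λ a b col ya≡yb → let (v , h , _) = both col in
            ℚₚ.<-irrefl refl (subst (0ℚ ℚ.<_) (trans (cong (signed v) (p≡q⇒q-p≡0 ya≡yb)) (signed-zero v)) h)
          weakly : CompatibleWith O x
          weakly a b e with to (Arrow-orient col? y a b) e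
          ... | col , ya<yb with both col
          ...   | true  , _ , c = ℤₚ.drop‿+≤+ (ℤtoℚ-cancel-≤ (0≤q-p⇒p≤q c))
          ...   | false , h , _ = contradiction (ℚₚ.<-trans (p<q⇒0<q-p ya<yb) (neg-neg h)) (ℚₚ.<-irrefl refl)

-- The two counting formulas, with the classical decisions discharged.

theorem4p2 : ∀ {d k} (L : MCC d k) → IsMCC L → AllLinesSameSize L → LatinExists L →
    ∀ {n} (reps : Vec (List (Fin d × Fin d)) n) → IsLatticeReps L reps →
    ∀ (μ : Fin n → ℤ) → IsMobiusFromBottom L reps μ →
    ∀ (E° E : Fin n → ℕ → ℕ) →
    (∀ i t → CountIs (OpenPts L (lookup reps i) t) (E° i t)) →
    (∀ i t → CountIs (ClosedPts L (lookup reps i) t) (E i t)) →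
    ∀ (t : ℕ) → 1 ≤ t →
    (∀ a → CountIs (LatinOpen L t) a → + a ≡ sumℤ (λ i → μ i * + E° i t))
    × (∀ b → CountIs (LcPair L t) b → + b ≡ sumℤ (λ i → + ∣ μ i ∣ * + E i t))
theorem4p2 {d} L _ same latin {n} reps isReps μ isμ E° E count° count t _ =
  (λ a hyp → classically λ col? complete T μ≡ν → trans
    (generic-count (λ i → E° i t) (λ i → count° i t) complete T hyp)
    (trans (∑-cong (allFin n) (λ i → cong (_* + E° i t) (sym (μ≡ν i)))) (sym (sumℤ-∑ (λ i → μ i * + E° i t))))) ,
  (λ b hyp → classically λ col? complete T μ≡ν → trans
    (pair-count (λ i → E i t) (λ i → count i t) complete T col? hyp)
    (trans (∑-cong (allFin n) (λ i → cong (λ m → + ∣ m ∣ * + E i t) (sym (μ≡ν i)))) (sym (sumℤ-∑ (λ i → + ∣ μ i ∣ * + E i t)))))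
  where
  open Geometry L
  open Lattice L same reps isReps
  classically : {z w : ℤ} →
    ((∀ a b → Dec (Collinear L a b)) → ∀ {A} (complete : Complete A) (T : Decided space A) →
     (∀ i → μ i ≡ ν T i) → z ≡ w) → z ≡ w
  classically {z} {w} h = decidable-stable (z ℤ.≟ w) λ k →
    ¬¬-Fin (λ a → ¬¬-Fin (λ b → ¬¬-excluded-middle)) λ col? →
    ¬¬-Fin (λ j → ¬¬-Fin (λ i → ¬¬-excluded-middle)) λ le? →
    -- Vanishing is decided for pairs of indices, a finite family, rather than for edges, which
    -- carry proofs.
    ¬¬-Fin (λ i → ¬¬-Fin (λ a → ¬¬-Fin (λ b → ¬¬-excluded-middle))) λ van? →
    ¬¬-decided space (proj₁ (edges latin col?)) λ T →
    k (h col? (proj₂ (edges latin col?)) T (μ≡ν (proj₂ (edges latin col?)) T le? van? isμ))
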